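{- Let $p<q$ be square-free integers $\ge 2$ with $p\equiv 2\pmod 4$ and $q\equiv 3\pmod 4$, put $r=pq/\gcd(p,q)^2$ and assume $p<q<r$. Let $K=\mathbb{Q}(\sqrt p,\sqrt q)$. Let $m$ be a positive integer with $m<\frac{r}{16\kappa\lceil\sqrt r\rceil}$ for some positive integer $\kappa$. Put $$N_1=\max\{\lceil 2\sqrt q-\sqrt p\rceil,\ \lceil\sqrt r-\sqrt p\rceil\}-\sqrt p,\qquad N_2=\max\{\lceil 2\sqrt p-\sqrt q\rceil,\ \lceil\sqrt r-\sqrt q\rceil\}-\sqrt q .$$ If $p\ge\left(m+\sqrt{2mN_1}\right)^2$ and $q\ge\left(m+\sqrt{2mN_2}\right)^2$, then not all elements of $m\mathcal{O}_K^+$ are sums of squares of elements of $\mathcal{O}_K$.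
   Context: $\mathcal{O}_K$ is the ring of integers of $K$, $\mathcal{O}_K^+$ is the set of its totally positive elements (all four real embeddings positive), and $m\mathcal{O}_K^+=\{m\alpha:\alpha\in\mathcal{O}_K^+\}$. A sum of squares in $\mathcal{O}_K$ is a finite sum $\sum_i\alpha_i^2$ with $\alpha_i\in\mathcal{O}_K$. The square roots in the hypotheses are real square roots, so the hypotheses presuppose $N_1,N_2\ge 0$. -}

module Defs where

open import Data.Integer.Base as ℤ using (ℤ; +_)
open import Data.Empty using (⊥; ⊥-elim)
open import Data.List.Base using (List; []; _∷_; map; foldr)
open import Data.List.Relation.Unary.All using (All)
open import Data.Nat.Base as ℕ using (ℕ; zero; suc)
open import Data.Nat.Divisibility using (_∣_)
import Data.Integer.Properties as ℤ
import Data.Nat.Properties as ℕ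
open import Data.Product.Base using (∃-syntax; _×_; _,_)
open import Data.Rational.Base as ℚ
  using (ℚ; 0ℚ; 1ℚ; ½; _+_; _*_; -_; _-_; ∣_∣; _<_; _≤_; _/_; 1/_)
import Data.Rational.Properties as ℚ
open import Data.Rational.Solver using (module +-*-Solver)
import Data.Rational.Unnormalised.Base as ℚᵘ
import Data.Rational.Unnormalised.Properties as ℚᵘ
open import Data.Sign.Base using (Sign)
open import Data.Sum.Base using (_⊎_; inj₁; inj₂)
open import Level using (0ℓ)
open import Relation.Binary.PropositionalEquality.Core
  using (_≡_; refl; sym; trans; cong; cong₂; subst)
open import Relation.Nullary.Decidable.Core using (yes; no)
open import Relation.Nullary.Negation.Core using (¬_)
open import Relation.Unary using (Pred)

open +-*-Solver using (solve; con; _:=_; _:+_; _:*_; _:-_; :-_)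

SquareFree : Pred ℕ 0ℓ
SquareFree n = ∀ {d} → d ℕ.* d ∣ n → d ≡ 1

-- Real numbers as Cauchy sequences of rationals. Equality is not
-- needed here; x and y are equal as reals when x ≤ᴿ y and y ≤ᴿ x.

IsCauchy : Pred (ℕ → ℚ) 0ℓ
IsCauchy x = ∀ ε → 0ℚ < ε →
  ∃[ N ] (∀ m n → N ℕ.≤ m → N ℕ.≤ n → ∣ x m - x n ∣ < ε)

record ℝ : Set where
  constructor mkℝ
  field
    seq    : ℕ → ℚ
    cauchy : IsCauchy seq

open ℝ public

infix 4 _<ᴿ_ _≤ᴿ_

_<ᴿ_ : ℝ → ℝ → Set
x <ᴿ y = ∃[ ε ] (0ℚ < ε × ∃[ N ] (∀ n → N ℕ.≤ n → seq x n + ε ≤ seq y n))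

_≤ᴿ_ : ℝ → ℝ → Set
x ≤ᴿ y = ¬ (y <ᴿ x)

ℚ→ℝ : ℚ → ℝ
ℚ→ℝ a = mkℝ (λ _ → a) λ ε ε>0 →
  0 , λ _ _ _ _ → subst (_< ε) (sym (cong ∣_∣ (ℚ.+-inverseʳ a))) ε>0

ℤ→ℝ : ℤ → ℝ
ℤ→ℝ i = ℚ→ℝ (i / 1)

ℕ→ℝ : ℕ → ℝ
ℕ→ℝ n = ℤ→ℝ (+ n)

0ℝ : ℝ
0ℝ = ℚ→ℝ 0ℚ

half : ∀ ε → ε * ½ + ε * ½ ≡ ε
half = solve 1 (λ e → e :* con ½ :+ e :* con ½ := e) refl

*-pos : ∀ {a b} → 0ℚ < a → 0ℚ < b → 0ℚ < a * b
*-pos {a} {b} a>0 b>0 =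
  subst (_< a * b) (ℚ.*-zeroʳ a)
    (ℚ.*-monoʳ-<-pos a {{ℚ.positive a>0}} b>0)

half-pos : ∀ {ε} → 0ℚ < ε → 0ℚ < ε * ½
half-pos ε>0 = *-pos ε>0 (ℚ.positive⁻¹ ½)

a≤∣a∣ : ∀ a → a ≤ ∣ a ∣
a≤∣a∣ a with ℚ.≤-total 0ℚ a
... | inj₁ 0≤a = ℚ.≤-reflexive (sym (ℚ.0≤p⇒∣p∣≡p 0≤a))
... | inj₂ a≤0 = ℚ.≤-trans a≤0 (ℚ.0≤∣p∣ a)

∣a∣<b : ∀ {a b} → a < b → - a < b → ∣ a ∣ < b
∣a∣<b {a} {b} a<b -a<b with ℚ.∣p∣≡p∨∣p∣≡-p a
... | inj₁ eq = subst (_< b) (sym eq) a<b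
... | inj₂ eq = subst (_< b) (sym eq) -a<b

swap-minus : ∀ a b → - (a - b) ≡ b - a
swap-minus = solve 2 (λ a b → :- (a :- b) := b :- a) refl

infixl 6 _+ᴿ_ _-ᴿ_
infixl 7 _*ᴿ_
infix  8 -ᴿ_

_+ᴿ_ : ℝ → ℝ → ℝ
mkℝ x cx +ᴿ mkℝ y cy = mkℝ (λ n → x n + y n) c
  where
  rearrange : ∀ a b a' b' → (a + b) - (a' + b') ≡ (a - a') + (b - b')
  rearrange = solve 4 (λ a b a' b' →
    (a :+ b) :- (a' :+ b') := (a :- a') :+ (b :- b')) refl

  c : IsCauchy (λ n → x n + y n)
  c ε ε>0 with cx (ε * ½) (half-pos ε>0) | cy (ε * ½) (half-pos ε>0)
  ... | M , hx | N , hy = M ℕ.⊔ N , λ m n p q → begin-strict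
    ∣ (x m + y m) - (x n + y n) ∣   ≡⟨ cong ∣_∣ (rearrange (x m) (y m) (x n) (y n)) ⟩
    ∣ (x m - x n) + (y m - y n) ∣   ≤⟨ ℚ.∣p+q∣≤∣p∣+∣q∣ (x m - x n) (y m - y n) ⟩
    ∣ x m - x n ∣ + ∣ y m - y n ∣   <⟨ ℚ.+-mono-<
      (hx m n (ℕ.m⊔n≤o⇒m≤o M N p) (ℕ.m⊔n≤o⇒m≤o M N q))
      (hy m n (ℕ.m⊔n≤o⇒n≤o M N p) (ℕ.m⊔n≤o⇒n≤o M N q)) ⟩
    ε * ½ + ε * ½                   ≡⟨ half ε ⟩
    ε                               ∎
    where open ℚ.≤-Reasoning

-ᴿ_ : ℝ → ℝ
-ᴿ mkℝ x cx = mkℝ (λ n → - x n) λ ε ε>0 →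
  let N , h = cx ε ε>0 in
  N , λ m n p q → subst (_< ε)
    (trans (sym (ℚ.∣-p∣≡∣p∣ (x m - x n))) (cong ∣_∣ (ℚ.neg-distrib-+ (x m) (- x n))))
    (h m n p q)

_-ᴿ_ : ℝ → ℝ → ℝ
x -ᴿ y = x +ᴿ (-ᴿ y)

bounded : ∀ x → IsCauchy x → ∃[ B ] (0ℚ < B × ∃[ N ] (∀ n → N ℕ.≤ n → ∣ x n ∣ < B))
bounded x cx with cx 1ℚ (ℚ.positive⁻¹ 1ℚ)
... | N , h = B , B>0 , N , λ n p → begin-strict
  ∣ x n ∣                   ≡⟨ cong ∣_∣ (split (x n) (x N)) ⟩
  ∣ x N + (x n - x N) ∣     ≤⟨ ℚ.∣p+q∣≤∣p∣+∣q∣ (x N) (x n - x N) ⟩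
  ∣ x N ∣ + ∣ x n - x N ∣   <⟨ ℚ.+-monoʳ-< ∣ x N ∣ (h n N p ℕ.≤-refl) ⟩
  B                         ∎
  where
  open ℚ.≤-Reasoning
  B = ∣ x N ∣ + 1ℚ
  B>0 = ℚ.+-mono-≤-< (ℚ.0≤∣p∣ (x N)) (ℚ.positive⁻¹ 1ℚ)
  split : ∀ a b → a ≡ b + (a - b)
  split = solve 2 (λ a b → a := b :+ (a :- b)) refl

_*ᴿ_ : ℝ → ℝ → ℝ
mkℝ x cx *ᴿ mkℝ y cy = mkℝ (λ n → x n * y n) c
  where
  rearrange : ∀ a b a' b' → a * b - a' * b' ≡ a * (b - b') + b' * (a - a')
  rearrange = solve 4 (λ a b a' b' →
    a :* b :- a' :* b' := a :* (b :- b') :+ b' :* (a :- a')) refl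

  term : ∀ {a B d δ} → 0ℚ < B → ∣ a ∣ < B → ∣ d ∣ < δ → ∣ a * d ∣ < B * δ
  term {a} {B} {d} {δ} B>0 a<B d<δ = begin-strict
    ∣ a * d ∣       ≡⟨ ℚ.∣p*q∣≡∣p∣*∣q∣ a d ⟩
    ∣ a ∣ * ∣ d ∣   ≤⟨ ℚ.*-monoʳ-≤-nonNeg ∣ d ∣ {{ℚ.∣-∣-nonNeg d}} (ℚ.<⇒≤ a<B) ⟩
    B * ∣ d ∣       <⟨ ℚ.*-monoʳ-<-pos B {{ℚ.positive B>0}} d<δ ⟩
    B * δ           ∎
    where open ℚ.≤-Reasoning

  scale : ∀ {B} → 0ℚ < B → ∀ η → 0ℚ < η → ∃[ δ ] (0ℚ < δ × B * δ ≡ η)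
  scale {B} B>0 η η>0 =
    1/ B * η ,
    *-pos (ℚ.positive⁻¹ (1/ B) {{ℚ.1/pos⇒pos B}}) η>0 ,
    trans (sym (ℚ.*-assoc B (1/ B) η))
      (trans (cong (_* η) (ℚ.*-inverseʳ B)) (ℚ.*-identityˡ η))
    where instance
      B⁺ = ℚ.positive B>0
      B≢0 = ℚ.pos⇒nonZero B

  close : ∀ {A B δ η ε a b a′ b′} → 0ℚ < A → 0ℚ < B → A * δ ≡ ε * ½ → B * η ≡ ε * ½ →
          ∣ a ∣ < A → ∣ b′ ∣ < B → ∣ b - b′ ∣ < δ → ∣ a - a′ ∣ < η →
          ∣ a * b - a′ * b′ ∣ < ε
  close {A} {B} {δ} {η} {ε} {a} {b} {a′} {b′} A>0 B>0 Aδ Bη a<A b′<B b~b′ a~a′ = begin-strict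
    ∣ a * b - a′ * b′ ∣                       ≡⟨ cong ∣_∣ (rearrange a b a′ b′) ⟩
    ∣ a * (b - b′) + b′ * (a - a′) ∣          ≤⟨ ℚ.∣p+q∣≤∣p∣+∣q∣ (a * (b - b′)) (b′ * (a - a′)) ⟩
    ∣ a * (b - b′) ∣ + ∣ b′ * (a - a′) ∣      <⟨ ℚ.+-mono-< (term {a} A>0 a<A b~b′) (term {b′} B>0 b′<B a~a′) ⟩
    A * δ + B * η                             ≡⟨ cong₂ _+_ Aδ Bη ⟩
    ε * ½ + ε * ½                             ≡⟨ half ε ⟩
    ε                                         ∎
    where open ℚ.≤-Reasoning

  c : IsCauchy (λ n → x n * y n)
  c ε ε>0 =
    let A , A>0 , N₁ , hA = bounded x cx
        B , B>0 , N₂ , hB = bounded y cy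
        δ , δ>0 , Aδ = scale A>0 (ε * ½) (half-pos ε>0)
        η , η>0 , Bη = scale B>0 (ε * ½) (half-pos ε>0)
        N₃ , hy = cy δ δ>0
        N₄ , hx = cx η η>0
        N₁₂ = N₁ ℕ.⊔ N₂
        N₃₄ = N₃ ℕ.⊔ N₄
    in N₁₂ ℕ.⊔ N₃₄ , λ m n p q →
      let m₁₂ = ℕ.m⊔n≤o⇒m≤o N₁₂ N₃₄ p
          m₃₄ = ℕ.m⊔n≤o⇒n≤o N₁₂ N₃₄ p
          n₁₂ = ℕ.m⊔n≤o⇒m≤o N₁₂ N₃₄ q
          n₃₄ = ℕ.m⊔n≤o⇒n≤o N₁₂ N₃₄ q
      in close A>0 B>0 Aδ Bη
        (hA m (ℕ.m⊔n≤o⇒m≤o N₁ N₂ m₁₂))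
        (hB n (ℕ.m⊔n≤o⇒n≤o N₁ N₂ n₁₂))
        (hy m n (ℕ.m⊔n≤o⇒m≤o N₃ N₄ m₃₄) (ℕ.m⊔n≤o⇒m≤o N₃ N₄ n₃₄))
        (hx m n (ℕ.m⊔n≤o⇒n≤o N₃ N₄ m₃₄) (ℕ.m⊔n≤o⇒n≤o N₃ N₄ n₃₄))

record SqrtApprox (a δ : ℚ) : Set where
  field
    s     : ℚ
    s≥0   : 0ℚ ≤ s
    lower : s ≡ 0ℚ ⊎ s * s ≤ a
    upper : a < (s + δ) * (s + δ)

mesh : ℕ → ℚ
mesh n = + 1 / suc n

ℕ→ℚ : ℕ → ℚ
ℕ→ℚ k = + k / 1

toℚᵘ-/ : ∀ i n .{{_ : ℕ.NonZero n}} → ℚ.toℚᵘ (i / n) ℚᵘ.≃ (i ℚᵘ./ n)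
toℚᵘ-/ i (suc n) = ℚ.toℚᵘ-fromℚᵘ (ℚᵘ.mkℚᵘ i n)

ℕ→ℚ-suc : ∀ k → ℕ→ℚ (suc k) ≡ ℕ→ℚ k + 1ℚ
ℕ→ℚ-suc k = ℚ.toℚᵘ-injective (begin
  ℚ.toℚᵘ (ℕ→ℚ (suc k))              ≈⟨ toℚᵘ-/ (+ suc k) 1 ⟩
  ℚᵘ.mkℚᵘ (+ suc k) 0               ≈⟨ ℚᵘ.*≡* (cong (ℤ._* + 1) k+1) ⟩
  ℚᵘ.mkℚᵘ (+ k) 0 ℚᵘ.+ ℚᵘ.1ℚᵘ       ≈⟨ ℚᵘ.+-congˡ ℚᵘ.1ℚᵘ (toℚᵘ-/ (+ k) 1) ⟨
  ℚ.toℚᵘ (ℕ→ℚ k) ℚᵘ.+ ℚ.toℚᵘ 1ℚ     ≈⟨ ℚ.toℚᵘ-homo-+ (ℕ→ℚ k) 1ℚ ⟨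
  ℚ.toℚᵘ (ℕ→ℚ k + 1ℚ)               ∎)
  where
  open ℚᵘ.≃-Reasoning
  k+1 : + suc k ≡ + k ℤ.* + 1 ℤ.+ + 1
  k+1 = trans (cong +_ (ℕ.+-comm 1 k)) (cong (ℤ._+ + 1) (sym (ℤ.*-identityʳ (+ k))))

ℕ→ℚ-* : ∀ j k → ℕ→ℚ (j ℕ.* k) ≡ ℕ→ℚ j * ℕ→ℚ k
ℕ→ℚ-* j k = ℚ.toℚᵘ-injective (begin
  ℚ.toℚᵘ (ℕ→ℚ (j ℕ.* k))                ≈⟨ toℚᵘ-/ (+ (j ℕ.* k)) 1 ⟩
  ℚᵘ.mkℚᵘ (+ (j ℕ.* k)) 0               ≈⟨ ℚᵘ.*≡* (cong (ℤ._* + 1) (ℤ.pos-* j k)) ⟩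
  ℚᵘ.mkℚᵘ (+ j) 0 ℚᵘ.* ℚᵘ.mkℚᵘ (+ k) 0  ≈⟨ ℚᵘ.*-cong (toℚᵘ-/ (+ j) 1) (toℚᵘ-/ (+ k) 1) ⟨
  ℚ.toℚᵘ (ℕ→ℚ j) ℚᵘ.* ℚ.toℚᵘ (ℕ→ℚ k)    ≈⟨ ℚ.toℚᵘ-homo-* (ℕ→ℚ j) (ℕ→ℚ k) ⟨
  ℚ.toℚᵘ (ℕ→ℚ j * ℕ→ℚ k)                ∎)
  where open ℚᵘ.≃-Reasoning

ℕ→ℚ-nonNeg : ∀ k → 0ℚ ≤ ℕ→ℚ k
ℕ→ℚ-nonNeg k = ℚ.nonNegative⁻¹ (ℕ→ℚ k) {{ℚ.normalize-nonNeg k 1}}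

mesh-pos : ∀ n → 0ℚ < mesh n
mesh-pos n = ℚ.positive⁻¹ (mesh n) {{ℚ.normalize-pos 1 (suc n)}}

suc*mesh : ∀ n → ℕ→ℚ (suc n) * mesh n ≡ 1ℚ
suc*mesh n = ℚ.toℚᵘ-injective (begin
  ℚ.toℚᵘ (ℕ→ℚ (suc n) * mesh n)                 ≈⟨ ℚ.toℚᵘ-homo-* (ℕ→ℚ (suc n)) (mesh n) ⟩
  ℚ.toℚᵘ (ℕ→ℚ (suc n)) ℚᵘ.* ℚ.toℚᵘ (mesh n)     ≈⟨ ℚᵘ.*-cong (toℚᵘ-/ (+ suc n) 1) (toℚᵘ-/ (+ 1) (suc n)) ⟩
  ℚᵘ.mkℚᵘ (+ suc n) 0 ℚᵘ.* ℚᵘ.mkℚᵘ (+ 1) n      ≈⟨ ℚᵘ.*≡* (cong +_ numerators) ⟩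
  ℚ.toℚᵘ 1ℚ                                     ∎)
  where
  open ℚᵘ.≃-Reasoning
  numerators : suc n ℕ.* 1 ℕ.* 1 ≡ 1 ℕ.* (1 ℕ.* suc n)
  numerators = trans (ℕ.*-identityʳ (suc n ℕ.* 1)) (trans (ℕ.*-comm (suc n) 1)
    (sym (ℕ.*-identityˡ (1 ℕ.* suc n))))

mesh-small : ∀ ε → 0ℚ < ε → ∃[ N ] (∀ n → N ℕ.≤ n → mesh n ≤ ε)
mesh-small ε@(ℚ.mkℚ (+ suc k) d _) _ = d , λ n d≤n →
  ℚ.toℚᵘ-cancel-≤ (ℚᵘ.≤-trans (ℚᵘ.≤-reflexive (toℚᵘ-/ (+ 1) (suc n)))
    (ℚᵘ.*≤* (ℤ.+≤+ (ℕ.*-mono-≤ (ℕ.s≤s (ℕ.z≤n {k})) (ℕ.s≤s d≤n)))))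
mesh-small (ℚ.mkℚ (+ zero) _ _) (ℚ.*<* (ℤ.+<+ ()))
mesh-small (ℚ.mkℚ ℤ.-[1+ _ ] _ _) (ℚ.*<* ())

a≤∣↥a∣ : ∀ a → a ≤ ℕ→ℚ ℤ.∣ ℚ.↥ a ∣
a≤∣↥a∣ a@(ℚ.mkℚ i d _) =
  ℚ.toℚᵘ-cancel-≤ (ℚᵘ.≤-trans (ℚᵘ.*≤* bound)
    (ℚᵘ.≤-reflexive (ℚᵘ.≃-sym (toℚᵘ-/ (+ ℤ.∣ i ∣) 1))))
  where
  i≤∣i∣ : ∀ i → i ℤ.≤ + ℤ.∣ i ∣
  i≤∣i∣ (+ _)       = ℤ.≤-refl
  i≤∣i∣ (ℤ.-[1+ _ ]) = ℤ.-≤+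
  bound : i ℤ.* + 1 ℤ.≤ + ℤ.∣ i ∣ ℤ.* + suc d
  bound = ℤ.≤-trans (ℤ.≤-reflexive (ℤ.*-identityʳ i)) (ℤ.≤-trans (i≤∣i∣ i)
    (ℤ.≤-trans (ℤ.+≤+ (ℕ.m≤m*n ℤ.∣ i ∣ (suc d)))
      (ℤ.≤-reflexive (ℤ.pos-* ℤ.∣ i ∣ (suc d)))))

-- Searches downwards for the largest k with (kδ)² ≤ a; if a < 0, the
-- search ends at 0.

scan : ∀ a δ → 0ℚ < δ → ∀ k → a < (ℕ→ℚ k * δ) * (ℕ→ℚ k * δ) → SqrtApprox a δ
scan a δ δ>0 zero a<0 = record
  { s = 0ℚ ; s≥0 = ℚ.≤-refl ; lower = inj₁ refl
  ; upper = ℚ.<-trans (subst (a <_) (cong₂ _*_ (ℚ.*-zeroˡ δ) (ℚ.*-zeroˡ δ)) a<0)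
      (subst (0ℚ <_) (cong₂ _*_ (sym (ℚ.+-identityˡ δ)) (sym (ℚ.+-identityˡ δ)))
        (*-pos δ>0 δ>0))
  }
scan a δ δ>0 (suc k) a<k+1 with (ℕ→ℚ k * δ) * (ℕ→ℚ k * δ) ℚ.≤? a
... | yes k≤a = record
  { s = ℕ→ℚ k * δ
  ; s≥0 = subst (_≤ ℕ→ℚ k * δ) (ℚ.*-zeroˡ δ)
      (ℚ.*-monoʳ-≤-nonNeg δ {{ℚ.nonNegative (ℚ.<⇒≤ δ>0)}} (ℕ→ℚ-nonNeg k))
  ; lower = inj₂ k≤a
  ; upper = subst (a <_) (cong₂ _*_ step step) a<k+1
  }
  where
  step : ℕ→ℚ (suc k) * δ ≡ ℕ→ℚ k * δ + δ
  step = trans (cong (_* δ) (ℕ→ℚ-suc k))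
    (trans (ℚ.*-distribʳ-+ δ (ℕ→ℚ k) 1ℚ) (cong (λ x → ℕ→ℚ k * δ + x) (ℚ.*-identityˡ δ)))
... | no k≰a = scan a δ δ>0 k (ℚ.≰⇒> k≰a)

sqrtApprox : ∀ a n → SqrtApprox a (mesh n)
sqrtApprox a n = scan a δ (mesh-pos n) (suc t ℕ.* suc n) (begin-strict
  a                                     ≤⟨ a≤∣↥a∣ a ⟩
  ℕ→ℚ t                                 ≡⟨ ℚ.+-identityʳ (ℕ→ℚ t) ⟨
  ℕ→ℚ t + 0ℚ                            <⟨ ℚ.+-monoʳ-< (ℕ→ℚ t) (ℚ.positive⁻¹ 1ℚ) ⟩
  ℕ→ℚ t + 1ℚ                            ≡⟨ ℕ→ℚ-suc t ⟨
  T                                     ≡⟨ ℚ.*-identityʳ T ⟨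
  T * 1ℚ                                ≤⟨ ℚ.*-monoˡ-≤-nonNeg T {{ℚ.nonNegative (ℕ→ℚ-nonNeg (suc t))}} 1≤T ⟩
  T * T                                 ≡⟨ cong₂ _*_ T≡ T≡ ⟩
  (ℕ→ℚ (suc t ℕ.* suc n) * δ) * (ℕ→ℚ (suc t ℕ.* suc n) * δ) ∎)
  where
  open ℚ.≤-Reasoning
  δ = mesh n
  t = ℤ.∣ ℚ.↥ a ∣
  T = ℕ→ℚ (suc t)
  1≤T : 1ℚ ≤ T
  1≤T = begin
    1ℚ           ≡⟨ ℚ.+-identityˡ 1ℚ ⟨
    0ℚ + 1ℚ      ≤⟨ ℚ.+-monoˡ-≤ 1ℚ (ℕ→ℚ-nonNeg t) ⟩
    ℕ→ℚ t + 1ℚ   ≡⟨ ℕ→ℚ-suc t ⟨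
    T            ∎
  T≡ : T ≡ ℕ→ℚ (suc t ℕ.* suc n) * δ
  T≡ = begin-equality
    T                             ≡⟨ ℚ.*-identityʳ T ⟨
    T * 1ℚ                        ≡⟨ cong (T *_) (suc*mesh n) ⟨
    T * (ℕ→ℚ (suc n) * δ)         ≡⟨ ℚ.*-assoc T (ℕ→ℚ (suc n)) δ ⟨
    T * ℕ→ℚ (suc n) * δ           ≡⟨ cong (_* δ) (ℕ→ℚ-* (suc t) (suc n)) ⟨
    ℕ→ℚ (suc t ℕ.* suc n) * δ     ∎

sq-mono : ∀ {a b} → 0ℚ ≤ a → a ≤ b → a * a ≤ b * b
sq-mono {a} {b} 0≤a a≤b = ℚ.≤-trans
  (ℚ.*-monoˡ-≤-nonNeg a {{ℚ.nonNegative 0≤a}} a≤b)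
  (ℚ.*-monoʳ-≤-nonNeg b {{ℚ.nonNegative (ℚ.≤-trans 0≤a a≤b)}} a≤b)

sqrt-gap : ∀ {a b δ δ′ η} (S : SqrtApprox a δ) (S′ : SqrtApprox b δ′) →
           0ℚ < η → 0ℚ < δ′ → δ′ ≤ η → ∣ a - b ∣ < η * η →
           SqrtApprox.s S < SqrtApprox.s S′ + (η + η)
sqrt-gap {a} {b} {δ} {δ′} {η} S S′ η>0 δ′>0 δ′≤η a~b
  with SqrtApprox.s S ℚ.<? SqrtApprox.s S′ + (η + η)
... | yes s<s′ = s<s′
... | no s≮s′ = ⊥-elim (absurd S.lower)
  where
  module S = SqrtApprox S
  module S′ = SqrtApprox S′
  open ℚ.≤-Reasoning
  s = S.s
  s′ = S′.s

  s′+2η≤s : s′ + (η + η) ≤ s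
  s′+2η≤s = ℚ.≮⇒≥ s≮s′

  s′+2η>0 : 0ℚ < s′ + (η + η)
  s′+2η>0 = ℚ.+-mono-≤-< S′.s≥0 (ℚ.+-mono-< η>0 η>0)

  s′+η≥0 : 0ℚ ≤ s′ + η
  s′+η≥0 = ℚ.+-mono-≤ S′.s≥0 (ℚ.<⇒≤ η>0)

  expand : ∀ s′ η → (s′ + (η + η)) * (s′ + (η + η)) ≡
           η * η + (s′ + η) * (s′ + η) + ((s′ + η) * η + (s′ + η) * η)
  expand = solve 2 (λ s′ η → (s′ :+ (η :+ η)) :* (s′ :+ (η :+ η)) :=
           η :* η :+ (s′ :+ η) :* (s′ :+ η) :+ ((s′ :+ η) :* η :+ (s′ :+ η) :* η)) refl

  split : ∀ a b → a ≡ (a - b) + b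
  split = solve 2 (λ a b → a := (a :- b) :+ b) refl

  product≥0 : 0ℚ ≤ (s′ + η) * η
  product≥0 = subst (_≤ (s′ + η) * η) (ℚ.*-zeroˡ η)
    (ℚ.*-monoʳ-≤-nonNeg η {{ℚ.nonNegative (ℚ.<⇒≤ η>0)}} s′+η≥0)

  absurd : S.s ≡ 0ℚ ⊎ S.s * S.s ≤ a → ⊥
  absurd (inj₁ s≡0) = ℚ.<-irrefl refl
    (ℚ.<-≤-trans s′+2η>0 (subst (s′ + (η + η) ≤_) s≡0 s′+2η≤s))
  absurd (inj₂ s²≤a) = ℚ.<-irrefl refl (begin-strict
    a                                         ≡⟨ split a b ⟩
    (a - b) + b                               ≤⟨ ℚ.+-monoˡ-≤ b (a≤∣a∣ (a - b)) ⟩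
    ∣ a - b ∣ + b                             <⟨ ℚ.+-mono-< a~b S′.upper ⟩
    η * η + (s′ + δ′) * (s′ + δ′)             ≤⟨ ℚ.+-monoʳ-≤ (η * η)
                                                   (sq-mono (ℚ.+-mono-≤ S′.s≥0 (ℚ.<⇒≤ δ′>0))
                                                            (ℚ.+-monoʳ-≤ s′ δ′≤η)) ⟩
    η * η + (s′ + η) * (s′ + η)               ≡⟨ ℚ.+-identityʳ _ ⟨
    η * η + (s′ + η) * (s′ + η) + 0ℚ          ≤⟨ ℚ.+-monoʳ-≤ (η * η + (s′ + η) * (s′ + η))
                                                   (ℚ.+-mono-≤ product≥0 product≥0) ⟩
    η * η + (s′ + η) * (s′ + η) + ((s′ + η) * η + (s′ + η) * η)
                                              ≡⟨ expand s′ η ⟨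
    (s′ + (η + η)) * (s′ + (η + η))           ≤⟨ sq-mono (ℚ.<⇒≤ s′+2η>0) s′+2η≤s ⟩
    s * s                                     ≤⟨ s²≤a ⟩
    a                                         ∎)

-- The square root of max(x, 0).

√_ : ℝ → ℝ
√ mkℝ x cx = mkℝ root c
  where
  root : ℕ → ℚ
  root n = SqrtApprox.s (sqrtApprox (x n) n)

  close : ∀ {a b δ δ′ η ε} (S : SqrtApprox a δ) (S′ : SqrtApprox b δ′) →
          η + η ≡ ε → 0ℚ < η → 0ℚ < δ′ → δ′ ≤ η → ∣ a - b ∣ < η * η →
          SqrtApprox.s S - SqrtApprox.s S′ < ε
  close {η = η} S S′ refl η>0 δ′>0 δ′≤η a~b =
    subst (s - s′ <_) (cancel s′ (η + η))
      (ℚ.+-monoˡ-< (- s′) (sqrt-gap S S′ η>0 δ′>0 δ′≤η a~b))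
    where
    s = SqrtApprox.s S
    s′ = SqrtApprox.s S′
    cancel : ∀ a b → (a + b) - a ≡ b
    cancel = solve 2 (λ a b → (a :+ b) :- a := b) refl

  c : IsCauchy root
  c ε ε>0 =
    let η = ε * ½
        η>0 = half-pos ε>0
        M , hm = mesh-small η η>0
        N , hx = cx (η * η) (*-pos η>0 η>0)
        diff = λ m n p q →
          close (sqrtApprox (x m) m) (sqrtApprox (x n) n) (half ε) η>0 (mesh-pos n)
            (hm n (ℕ.m⊔n≤o⇒m≤o M N q))
            (hx m n (ℕ.m⊔n≤o⇒n≤o M N p) (ℕ.m⊔n≤o⇒n≤o M N q))
    in M ℕ.⊔ N , λ m n p q →
      ∣a∣<b (diff m n p q)
        (subst (_< ε) (sym (swap-minus (root m) (root n))) (diff n m q p))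

_◃ᴿ_ : Sign → ℝ → ℝ
Sign.+ ◃ᴿ x = x
Sign.- ◃ᴿ x = -ᴿ x

IsCeiling : ℝ → ℤ → Set
IsCeiling x c = (ℤ→ℝ (c ℤ.- + 1) <ᴿ x) × (x ≤ᴿ ℤ→ℝ c)

-- The biquadratic field ℚ(√p , √q), with the element
-- a + b√p + c√q + d√p√q stored as its coordinates. The indices are
-- arbitrary here; this is a field of degree 4 over ℚ exactly when none
-- of p, q and pq is a perfect square.

record Biquadratic (p q : ℕ) : Set where
  constructor ⟨_,_,_,_⟩
  field
    coeff₁ coeff√p coeff√q coeff√p√q : ℚ

module _ {p q : ℕ} where

  private
    K = Biquadratic p q
    P = + p / 1
    Q = + q / 1

  infixl 6 _+ᴷ_
  infixl 7 _*ᴷ_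

  ℤ→ᴷ : ℤ → K
  ℤ→ᴷ i = ⟨ i / 1 , 0ℚ , 0ℚ , 0ℚ ⟩

  0ᴷ 1ᴷ : K
  0ᴷ = ℤ→ᴷ (+ 0)
  1ᴷ = ℤ→ᴷ (+ 1)

  _+ᴷ_ : K → K → K
  ⟨ a , b , c , d ⟩ +ᴷ ⟨ a′ , b′ , c′ , d′ ⟩ =
    ⟨ a + a′ , b + b′ , c + c′ , d + d′ ⟩

  _*ᴷ_ : K → K → K
  ⟨ a , b , c , d ⟩ *ᴷ ⟨ a′ , b′ , c′ , d′ ⟩ =
    ⟨ a * a′ + P * (b * b′) + Q * (c * c′) + P * Q * (d * d′)
    , a * b′ + b * a′ + Q * (c * d′ + d * c′)
    , a * c′ + c * a′ + P * (b * d′ + d * b′)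
    , a * d′ + d * a′ + b * c′ + c * b′
    ⟩

  -- The list c₀ , … , cₙ₋₁ stands for c₀ + c₁X + … + cₙ₋₁Xⁿ⁻¹ + Xⁿ.

  evalMonic : List ℤ → K → K
  evalMonic []       α = 1ᴷ
  evalMonic (c ∷ cs) α = ℤ→ᴷ c +ᴷ α *ᴷ evalMonic cs α

  -- The real embedding sending √p to s√p and √q to t√q.

  embed : Sign → Sign → K → ℝ
  embed s t ⟨ a , b , c , d ⟩ =
    ℚ→ℝ a +ᴿ ℚ→ℝ b *ᴿ u +ᴿ ℚ→ℝ c *ᴿ v +ᴿ ℚ→ℝ d *ᴿ (u *ᴿ v)
    where
    u = s ◃ᴿ (√ ℕ→ℝ p)
    v = t ◃ᴿ (√ ℕ→ℝ q)

  TotallyPositive : Pred K 0ℓ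
  TotallyPositive α = ∀ s t → 0ℝ <ᴿ embed s t α

module _ (p q : ℕ) where

  𝒪 : Pred (Biquadratic p q) 0ℓ
  𝒪 α = ∃[ cs ] evalMonic cs α ≡ 0ᴷ

  𝒪⁺ : Pred (Biquadratic p q) 0ℓ
  𝒪⁺ α = 𝒪 α × TotallyPositive α

  _·𝒪⁺ : ℕ → Pred (Biquadratic p q) 0ℓ
  (m ·𝒪⁺) β = ∃[ α ] (𝒪⁺ α × β ≡ ℤ→ᴷ (+ m) *ᴷ α)

  SumOfSquares : Pred (Biquadratic p q) 0ℓ
  SumOfSquares β = ∃[ αs ] (All 𝒪 αs × β ≡ foldr _+ᴷ_ 0ᴷ (map (λ α → α *ᴷ α) αs))

{-# OPTIONS --safe #-}

-- Let A be the smaller of ⌈√r⌉ and N₁ + √p. Then A² > p, so α = A + √p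
-- is totally positive, while 16mA < r, and the bound on p gives mA ≤ p.
-- Suppose that mα is a sum of squares, and let N be the rational part
-- of the square of one term γ = a + b√p + c√q + d√p√q. The rational
-- parts of squares are nonnegative, so N ≤ mA. For g = gcd(p, q),
-- integrality of γ forces 4gd ∈ ℤ, and 16N ≥ 16pqd² = r(4gd)²; as
-- 16N < r, d = 0. Then b ∈ ℤ because p ≡ 2 and q ≡ 3 (mod 4), and
-- a² + pb² ≤ N ≤ p leaves only ab = 0. So no square contributes to the
-- coefficient m of √p.
--
-- Integrality is used through almost integrality: the powers of an
-- algebraic integer have a common denominator. This property passes to
-- sums, products and conjugates, and rational numbers having it are
-- integers, so traces and norms of algebraic integers are integers.

module Submission where

open import Defs
open import Data.Empty using (⊥-elim)
open import Data.Integer.Base as ℤ using (ℤ; +_; -[1+_])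
import Data.Integer.DivMod as ℤ
import Data.Integer.Properties as ℤ
open import Data.Integer.Tactic.RingSolver using (solve-∀)
open import Data.List.Base using (List; []; _∷_; length; map; foldr)
open import Data.List.Relation.Unary.All using (All; []; _∷_)
open import Data.Nat.Base as ℕ using (ℕ; zero; suc)
open import Data.Nat.Coprimality as Coprime using (Coprime; coprime-divisor)
open import Data.Nat.Divisibility using (_∣_; divides; ∣-trans; ∣⇒≤; *-monoʳ-∣)
import Data.Nat.DivMod as ℕ
open import Data.Nat.GCD using (gcd; gcd-GCD; gcd[m,n]≢0; module Bézout)
import Data.Nat.Properties as ℕ
open import Data.Product.Base using (Σ; ∃-syntax; _×_; _,_; proj₁; proj₂)
open import Data.Rational.Base as ℚ using (ℚ; mkℚ; 0ℚ; 1ℚ; ½)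
import Data.Rational.Properties as ℚ
open import Data.Rational.Solver using (module +-*-Solver)
import Data.Rational.Unnormalised.Base as ℚᵘ
import Data.Rational.Unnormalised.Properties as ℚᵘ
open import Data.Sign.Base using (Sign)
open import Data.Sum.Base using (_⊎_; inj₁; inj₂)
open import Function.Base using (_∘_)
open import Relation.Binary.Definitions using (tri<; tri≈; tri>)
open import Relation.Binary.PropositionalEquality
  using (_≡_; _≢_; refl; sym; trans; cong; cong₂; subst; module ≡-Reasoning)
open import Relation.Nullary.Decidable.Core using (yes; no)
open import Relation.Nullary.Negation.Core using (¬_)
open import Relation.Unary using (_⊆_)

-- Taking a minimum reconciles two hypotheses: the bound on m limits only m⌈√r⌉, and the bound on p
-- limits only m(N₁ + √p). Both upper bounds pass to the minimum, while p ≤ A² holds for either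
-- candidate: r ≤ ⌈√r⌉² with p < r, and N₁ ≥ 0. With M = N₁ + √p, an integer, the bound on p gives
-- m² + 2m(M - √p) ≤ p, which an estimate of 2m√p turns into mM ≤ p.
--
-- Real numbers enter only through the hypotheses and total positivity; squares are compared in
-- rational coordinates. Since `≤ᴿ` is a negated strict inequality, it yields inequalities between
-- approximations only up to ε and only at some index beyond any given one. Nothing is lost, because
-- each conclusion drawn from it compares integers and tolerates an error below 1.
--
-- Membership in `𝒪` supplies an arbitrary monic polynomial, from which no polynomial for a sum or a
-- product can be read off directly. For almost integral elements, closure only multiplies
-- denominators.

module _ where
  open import Data.Integer.Base using (_+_; _*_; _-_; ∣_∣; _%ℕ_; _/ℕ_)

  -- Parity and congruences modulo 4.

  data Parity : ℤ → Set where
    even : ∀ k → Parity (+ 2 * k)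
    odd  : ∀ k → Parity (+ 2 * k + + 1)

  parity : ∀ i → Parity i
  parity i with i %ℕ 2 | ℤ.n%ℕd<d i 2 | ℤ.a≡a%ℕn+[a/ℕn]*n i 2
  ... | 0 | _ | eq = subst Parity (sym (trans eq (lemma (i /ℕ 2)))) (even (i /ℕ 2))
    where
    lemma : ∀ k → + 0 + k * + 2 ≡ + 2 * k
    lemma = solve-∀
  ... | 1 | _ | eq = subst Parity (sym (trans eq (lemma (i /ℕ 2)))) (odd (i /ℕ 2))
    where
    lemma : ∀ k → + 1 + k * + 2 ≡ + 2 * k + + 1
    lemma = solve-∀
  ... | suc (suc _) | ℕ.s≤s (ℕ.s≤s ()) | _

  even≢odd : ∀ i j → + 2 * i ≢ + 2 * j + + 1
  even≢odd i j eq = 2k≢1 (i - j) (trans (distrib i j) (trans (cong (_- + 2 * j) eq) (cancel j)))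
    where
    distrib : ∀ i j → + 2 * (i - j) ≡ + 2 * i - + 2 * j
    distrib = solve-∀
    cancel : ∀ j → + 2 * j + + 1 - + 2 * j ≡ + 1
    cancel = solve-∀
    2k≢1 : ∀ k → + 2 * k ≢ + 1
    2k≢1 k eq with ℕ.m*n≡1⇒m≡1 2 ∣ k ∣ (trans (sym (ℤ.abs-* (+ 2) k)) (cong ∣_∣ eq))
    ... | ()

  4i≢4j+2 : ∀ i j → + 4 * i ≢ + 4 * j + + 2
  4i≢4j+2 i j eq = even≢odd i j (ℤ.*-cancelˡ-≡ (+ 2) _ _ (trans (lhs i) (trans eq (rhs j))))
    where
    lhs : ∀ i → + 2 * (+ 2 * i) ≡ + 4 * i
    lhs = solve-∀
    rhs : ∀ j → + 4 * j + + 2 ≡ + 2 * (+ 2 * j + + 1)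
    rhs = solve-∀

  Even : ℤ → Set
  Even i = ∃[ k ] i ≡ + 2 * k

  residue : ∀ n {e} → n ℕ.% 4 ≡ e → + n ≡ + 4 * + (n ℕ./ 4) + + e
  residue n {e} eq = trans (cong +_ decomposed) (cong (_+ + e) (ℤ.pos-* 4 (n ℕ./ 4)))
    where
    open ≡-Reasoning
    decomposed : n ≡ 4 ℕ.* (n ℕ./ 4) ℕ.+ e
    decomposed = begin
      n                            ≡⟨ ℕ.m≡m%n+[m/n]*n n 4 ⟩
      n ℕ.% 4 ℕ.+ n ℕ./ 4 ℕ.* 4    ≡⟨ cong (ℕ._+ n ℕ./ 4 ℕ.* 4) eq ⟩
      e ℕ.+ n ℕ./ 4 ℕ.* 4          ≡⟨ ℕ.+-comm e (n ℕ./ 4 ℕ.* 4) ⟩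
      n ℕ./ 4 ℕ.* 4 ℕ.+ e          ≡⟨ cong (ℕ._+ e) (ℕ.*-comm (n ℕ./ 4) 4) ⟩
      4 ℕ.* (n ℕ./ 4) ℕ.+ e        ∎

  -- Squares are 0 or 1 modulo 4. This later excludes p = A², so that A + √p is strictly positive
  -- under every embedding.
  square≢2mod4 : ∀ N x → x * x ≢ + 4 * N + + 2
  square≢2mod4 N x eq with parity x
  ... | even k = 4i≢4j+2 (k * k) N (trans (lemma k) eq)
    where
    lemma : ∀ k → + 4 * (k * k) ≡ + 2 * k * (+ 2 * k)
    lemma = solve-∀
  ... | odd k = even≢odd (+ 2 * N + + 1) (+ 2 * (k * k + k)) (trans (lhs N) (trans (sym eq) (rhs k)))
    where
    lhs : ∀ N → + 2 * (+ 2 * N + + 1) ≡ + 4 * N + + 2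
    lhs = solve-∀
    rhs : ∀ k → (+ 2 * k + + 1) * (+ 2 * k + + 1) ≡ + 2 * (+ 2 * (k * k + k)) + + 1
    rhs = solve-∀

  -- The right side is even, hence so is x; then 2y² ≡ 0 (mod 4) makes y even. In the application x
  -- and y are the doubled coordinates of an element of ℚ(√p) with norm z.
  norm-even : ∀ N x y z → x * x ≡ (+ 4 * N + + 2) * (y * y) + + 4 * z → Even x × Even y
  norm-even N x y z eq with parity x | parity y
  ... | even k | even l = (k , refl) , (l , refl)
  ... | even k | odd l = ⊥-elim (4i≢4j+2 (k * k) (N * (+ 2 * l + + 1) * (+ 2 * l + + 1) + + 2 * (l * l + l) + z)
      (trans (lhs k) (trans eq (rhs N l z))))
    where
    lhs : ∀ k → + 4 * (k * k) ≡ + 2 * k * (+ 2 * k)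
    lhs = solve-∀
    rhs : ∀ N l z → (+ 4 * N + + 2) * ((+ 2 * l + + 1) * (+ 2 * l + + 1)) + + 4 * z ≡
          + 4 * (N * (+ 2 * l + + 1) * (+ 2 * l + + 1) + + 2 * (l * l + l) + z) + + 2
    rhs = solve-∀
  ... | odd k | _ = ⊥-elim (even≢odd ((+ 2 * N + + 1) * (y * y) + + 2 * z) (+ 2 * (k * k + k))
      (trans (lhs N y z) (trans (sym eq) (rhs k))))
    where
    lhs : ∀ N y z → + 2 * ((+ 2 * N + + 1) * (y * y) + + 2 * z) ≡ (+ 4 * N + + 2) * (y * y) + + 4 * z
    lhs = solve-∀
    rhs : ∀ k → (+ 2 * k + + 1) * (+ 2 * k + + 1) ≡ + 2 * (+ 2 * (k * k + k)) + + 1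
    rhs = solve-∀

  -- If y were odd, the first equation would make x even, and the second would read 2 ≡ 3z² (mod 4),
  -- where 3z² can only be 0 or 3. Here x, y, z are to be 2a, 2b, 2c for an integer a + b√p + c√q of
  -- the field.
  relative-norm-even : ∀ P Q x y z u w → x * y ≡ + 2 * u →
    x * x + (+ 4 * P + + 2) * (y * y) ≡ (+ 4 * Q + + 3) * (z * z) + + 4 * w → Even y
  relative-norm-even P Q x y z u w xy eq with parity y
  ... | even l = l , refl
  ... | odd l with parity x | parity z
  ...   | odd k | _ = ⊥-elim (even≢odd u (+ 2 * (k * l) + k + l) (trans (sym xy) (lemma k l)))
    where
    lemma : ∀ k l → (+ 2 * k + + 1) * (+ 2 * l + + 1) ≡ + 2 * (+ 2 * (k * l) + k + l) + + 1
    lemma = solve-∀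
  ...   | even k | even j = ⊥-elim (4i≢4j+2 ((+ 4 * Q + + 3) * (j * j) + w)
      (k * k + P * (+ 2 * l + + 1) * (+ 2 * l + + 1) + + 2 * (l * l + l))
      (trans (rhs Q j w) (trans (sym eq) (lhs P k l))))
    where
    lhs : ∀ P k l → + 2 * k * (+ 2 * k) + (+ 4 * P + + 2) * ((+ 2 * l + + 1) * (+ 2 * l + + 1)) ≡
          + 4 * (k * k + P * (+ 2 * l + + 1) * (+ 2 * l + + 1) + + 2 * (l * l + l)) + + 2
    lhs = solve-∀
    rhs : ∀ Q j w → + 4 * ((+ 4 * Q + + 3) * (j * j) + w) ≡ (+ 4 * Q + + 3) * (+ 2 * j * (+ 2 * j)) + + 4 * w
    rhs = solve-∀
  ...   | even k | odd j = ⊥-elim (even≢odd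
      (+ 2 * (k * k) + (+ 2 * P + + 1) * ((+ 2 * l + + 1) * (+ 2 * l + + 1)))
      (+ 2 * Q * ((+ 2 * j + + 1) * (+ 2 * j + + 1)) + + 6 * (j * j + j) + + 1 + + 2 * w)
      (trans (lhs P k l) (trans eq (rhs Q j w))))
    where
    lhs : ∀ P k l → + 2 * (+ 2 * (k * k) + (+ 2 * P + + 1) * ((+ 2 * l + + 1) * (+ 2 * l + + 1))) ≡
          + 2 * k * (+ 2 * k) + (+ 4 * P + + 2) * ((+ 2 * l + + 1) * (+ 2 * l + + 1))
    lhs = solve-∀
    rhs : ∀ Q j w → (+ 4 * Q + + 3) * ((+ 2 * j + + 1) * (+ 2 * j + + 1)) + + 4 * w ≡
          + 2 * (+ 2 * Q * ((+ 2 * j + + 1) * (+ 2 * j + + 1)) + + 6 * (j * j + j) + + 1 + + 2 * w) + + 1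
    rhs = solve-∀

-- Integers among the rationals.

module _ where
  open import Data.Rational.Base using (_+_; _*_; -_; _-_; ∣_∣; _<_; _≤_; _/_)
  open +-*-Solver using (Polynomial; solve; con; _:=_; _:+_; _:*_; _:-_; :-_)

  ι : ℤ → ℚ
  ι i = i / 1

  ι-+ : ∀ i j → ι (i ℤ.+ j) ≡ ι i + ι j
  ι-+ i j = ℚ.toℚᵘ-injective (begin
    ℚ.toℚᵘ (ι (i ℤ.+ j))                   ≈⟨ toℚᵘ-/ (i ℤ.+ j) 1 ⟩
    ℚᵘ.mkℚᵘ (i ℤ.+ j) 0                    ≈⟨ ℚᵘ.*≡* (cong (ℤ._* + 1) (cong₂ ℤ._+_ (ℤ.*-identityʳ i) (ℤ.*-identityʳ j))) ⟨
    ℚᵘ.mkℚᵘ i 0 ℚᵘ.+ ℚᵘ.mkℚᵘ j 0           ≈⟨ ℚᵘ.+-cong (toℚᵘ-/ i 1) (toℚᵘ-/ j 1) ⟨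
    ℚ.toℚᵘ (ι i) ℚᵘ.+ ℚ.toℚᵘ (ι j)         ≈⟨ ℚ.toℚᵘ-homo-+ (ι i) (ι j) ⟨
    ℚ.toℚᵘ (ι i + ι j)                     ∎)
    where open ℚᵘ.≃-Reasoning

  ι-* : ∀ i j → ι (i ℤ.* j) ≡ ι i * ι j
  ι-* i j = ℚ.toℚᵘ-injective (begin
    ℚ.toℚᵘ (ι (i ℤ.* j))                   ≈⟨ toℚᵘ-/ (i ℤ.* j) 1 ⟩
    ℚᵘ.mkℚᵘ i 0 ℚᵘ.* ℚᵘ.mkℚᵘ j 0           ≈⟨ ℚᵘ.*-cong (toℚᵘ-/ i 1) (toℚᵘ-/ j 1) ⟨
    ℚ.toℚᵘ (ι i) ℚᵘ.* ℚ.toℚᵘ (ι j)         ≈⟨ ℚ.toℚᵘ-homo-* (ι i) (ι j) ⟨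
    ℚ.toℚᵘ (ι i * ι j)                     ∎)
    where open ℚᵘ.≃-Reasoning

  ι-neg : ∀ i → ι (ℤ.- i) ≡ - ι i
  ι-neg i = ℚ.toℚᵘ-injective (begin
    ℚ.toℚᵘ (ι (ℤ.- i))       ≈⟨ toℚᵘ-/ (ℤ.- i) 1 ⟩
    ℚᵘ.- ℚᵘ.mkℚᵘ i 0         ≈⟨ ℚᵘ.-‿cong (toℚᵘ-/ i 1) ⟨
    ℚᵘ.- ℚ.toℚᵘ (ι i)        ≈⟨ ℚ.toℚᵘ-homo‿- (ι i) ⟨
    ℚ.toℚᵘ (- ι i)           ∎)
    where open ℚᵘ.≃-Reasoning

  ι-- : ∀ i j → ι (i ℤ.- j) ≡ ι i - ι j
  ι-- i j = trans (ι-+ i (ℤ.- j)) (cong (λ t → ι i + t) (ι-neg j))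

  ι-injective : ∀ {i j} → ι i ≡ ι j → i ≡ j
  ι-injective {i} {j} eq with ℚ.fromℚᵘ-injective {ℚᵘ.mkℚᵘ i 0} {ℚᵘ.mkℚᵘ j 0} eq
  ... | ℚᵘ.*≡* i*1≡j*1 = trans (sym (ℤ.*-identityʳ i)) (trans i*1≡j*1 (ℤ.*-identityʳ j))

  ι-mono-≤ : ∀ {i j} → i ℤ.≤ j → ι i ≤ ι j
  ι-mono-≤ {i} {j} i≤j = ℚ.toℚᵘ-cancel-≤ (begin
    ℚ.toℚᵘ (ι i)     ≃⟨ toℚᵘ-/ i 1 ⟩
    ℚᵘ.mkℚᵘ i 0      ≤⟨ ℚᵘ.*≤* (ℤ.*-monoʳ-≤-nonNeg (+ 1) i≤j) ⟩
    ℚᵘ.mkℚᵘ j 0      ≃⟨ toℚᵘ-/ j 1 ⟨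
    ℚ.toℚᵘ (ι j)     ∎)
    where open ℚᵘ.≤-Reasoning

  ι-mono-< : ∀ {i j} → i ℤ.< j → ι i < ι j
  ι-mono-< {i} {j} i<j = begin-strict
    ι i            ≡⟨ ℚ.+-identityˡ (ι i) ⟨
    0ℚ + ι i       <⟨ ℚ.+-monoˡ-< (ι i) (ℚ.positive⁻¹ 1ℚ) ⟩
    1ℚ + ι i       ≡⟨ ι-+ (+ 1) i ⟨
    ι (ℤ.suc i)    ≤⟨ ι-mono-≤ (ℤ.i<j⇒suc[i]≤j i<j) ⟩
    ι j            ∎
    where open ℚ.≤-Reasoning

  IsInt : ℚ → Set
  IsInt x = ∃[ z ] x ≡ ι z

  int-+ : ∀ {x y} → IsInt x → IsInt y → IsInt (x + y)
  int-+ (i , refl) (j , refl) = i ℤ.+ j , sym (ι-+ i j)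

  int-* : ∀ {x y} → IsInt x → IsInt y → IsInt (x * y)
  int-* (i , refl) (j , refl) = i ℤ.* j , sym (ι-* i j)

  int-neg : ∀ {x} → IsInt x → IsInt (- x)
  int-neg (i , refl) = ℤ.- i , sym (ι-neg i)

  int-- : ∀ {x y} → IsInt x → IsInt y → IsInt (x - y)
  int-- hx hy = int-+ hx (int-neg hy)

  int-multiple : ∀ x D E → IsInt (ℕ→ℚ E * x) → IsInt (ℕ→ℚ (D ℕ.* E) * x)
  int-multiple x D E h = subst IsInt
    (trans (sym (ℚ.*-assoc (ℕ→ℚ D) (ℕ→ℚ E) x)) (cong (_* x) (sym (ℕ→ℚ-* D E))))
    (int-* (+ D , refl) h)

  *-denominator : ∀ x → x * ι (ℚ.↧ x) ≡ ι (ℚ.↥ x)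
  *-denominator x@(mkℚ n d _) = ℚ.toℚᵘ-injective (begin
    ℚ.toℚᵘ (x * ι (+ suc d))              ≈⟨ ℚ.toℚᵘ-homo-* x (ι (+ suc d)) ⟩
    ℚ.toℚᵘ x ℚᵘ.* ℚ.toℚᵘ (ι (+ suc d))    ≈⟨ ℚᵘ.*-cong (ℚᵘ.≃-refl {ℚ.toℚᵘ x}) (toℚᵘ-/ (+ suc d) 1) ⟩
    ℚ.toℚᵘ x ℚᵘ.* ℚᵘ.mkℚᵘ (+ suc d) 0     ≈⟨ ℚᵘ.*≡*
      (trans (ℤ.*-identityʳ (n ℤ.* + suc d)) (cong (λ e → n ℤ.* + e) (sym (ℕ.*-identityʳ (suc d))))) ⟩
    ℚᵘ.mkℚᵘ n 0                           ≈⟨ toℚᵘ-/ n 1 ⟨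
    ℚ.toℚᵘ (ι n)                          ∎)
    where open ℚᵘ.≃-Reasoning

  denominator≡1⇒int : ∀ x → ℚ.↧ₙ x ≡ 1 → IsInt x
  denominator≡1⇒int x ↧x≡1 = ℚ.↥ x ,
    trans (sym (ℚ.*-identityʳ x))
      (trans (cong (λ d → x * ι (+ d)) (sym ↧x≡1)) (*-denominator x))

  numerator-coprime : ∀ x → Coprime (ℚ.↧ₙ x) ℤ.∣ ℚ.↥ x ∣
  numerator-coprime (mkℚ n d c) = Coprime.sym (Coprime.recompute c)

  coprime-square : ∀ {m n} → Coprime m n → Coprime (m ℕ.* m) n
  coprime-square {m} {n} m⊥n {e} (e∣mm , e∣n) = m⊥n (coprime-divisor e⊥m e∣mm , e∣n)
    where
    e⊥m : Coprime e m
    e⊥m (f∣e , f∣m) = m⊥n (f∣m , ∣-trans f∣e e∣n)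

  -- For x = s/d in lowest terms, d² divides ns² and is coprime to s, so d² divides n.
  squareFree-int : ∀ {n} x → SquareFree n → IsInt (ι (+ n) * (x * x)) → IsInt x
  squareFree-int {n} x n-sf (z , eq) = denominator≡1⇒int x (n-sf dd∣n)
    where
    open ≡-Reasoning
    s = ℚ.↥ x
    d = ℚ.↧ₙ x

    cleared : + n ℤ.* (s ℤ.* s) ≡ z ℤ.* (+ d ℤ.* + d)
    cleared = ι-injective (begin
      ι (+ n ℤ.* (s ℤ.* s))                  ≡⟨ trans (ι-* (+ n) (s ℤ.* s)) (cong (ι (+ n) *_) (ι-* s s)) ⟩
      ι (+ n) * (ι s * ι s)                  ≡⟨ cong (λ t → ι (+ n) * (t * t)) (*-denominator x) ⟨
      ι (+ n) * (x * ι (+ d) * (x * ι (+ d)))  ≡⟨ solve 3 (λ n x d → n :* (x :* d :* (x :* d)) := n :* (x :* x) :* (d :* d)) refl (ι (+ n)) x (ι (+ d)) ⟩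
      ι (+ n) * (x * x) * (ι (+ d) * ι (+ d))  ≡⟨ cong₂ _*_ eq (sym (ι-* (+ d) (+ d))) ⟩
      ι z * ι (+ d ℤ.* + d)                  ≡⟨ ι-* z (+ d ℤ.* + d) ⟨
      ι (z ℤ.* (+ d ℤ.* + d))                ∎)

    dd∣ssn : d ℕ.* d ∣ ℤ.∣ s ∣ ℕ.* (ℤ.∣ s ∣ ℕ.* n)
    dd∣ssn = divides ℤ.∣ z ∣ (begin
      ℤ.∣ s ∣ ℕ.* (ℤ.∣ s ∣ ℕ.* n)   ≡⟨ ℕ.*-assoc ℤ.∣ s ∣ ℤ.∣ s ∣ n ⟨
      ℤ.∣ s ∣ ℕ.* ℤ.∣ s ∣ ℕ.* n     ≡⟨ ℕ.*-comm (ℤ.∣ s ∣ ℕ.* ℤ.∣ s ∣) n ⟩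
      n ℕ.* (ℤ.∣ s ∣ ℕ.* ℤ.∣ s ∣)   ≡⟨ cong (n ℕ.*_) (ℤ.abs-* s s) ⟨
      n ℕ.* ℤ.∣ s ℤ.* s ∣           ≡⟨ ℤ.abs-* (+ n) (s ℤ.* s) ⟨
      ℤ.∣ + n ℤ.* (s ℤ.* s) ∣       ≡⟨ cong ℤ.∣_∣ cleared ⟩
      ℤ.∣ z ℤ.* (+ d ℤ.* + d) ∣     ≡⟨ ℤ.abs-* z (+ d ℤ.* + d) ⟩
      ℤ.∣ z ∣ ℕ.* ℤ.∣ + d ℤ.* + d ∣ ≡⟨ cong (ℤ.∣ z ∣ ℕ.*_) (ℤ.abs-* (+ d) (+ d)) ⟩
      ℤ.∣ z ∣ ℕ.* (d ℕ.* d)         ∎)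

    dd⊥s : Coprime (d ℕ.* d) ℤ.∣ s ∣
    dd⊥s = coprime-square (numerator-coprime x)

    dd∣n : d ℕ.* d ∣ n
    dd∣n = coprime-divisor dd⊥s (coprime-divisor dd⊥s dd∣ssn)

  -- The y k form a geometric sequence of ratio n/d. Coprimality makes every term divisible by d,
  -- and the quotients again form a sequence of the same kind; hence y is quantified inside the
  -- induction on j.
  power-divides : ∀ {d n} .{{_ : ℕ.NonZero d}} → Coprime d n → (y : ℕ → ℕ) →
                  (∀ k → y (suc k) ℕ.* d ≡ n ℕ.* y k) → ∀ j → d ℕ.^ j ∣ y 0
  power-divides d⊥n y step zero = divides (y 0) (sym (ℕ.*-identityʳ (y 0)))
  power-divides {d} {n} d⊥n y step (suc j) =
    subst (d ℕ.* d ℕ.^ j ∣_) (trans (ℕ.*-comm d (z 0)) (sym (zd 0)))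
      (*-monoʳ-∣ d (power-divides d⊥n z z-step j))
    where
    d∣y : ∀ k → d ∣ y k
    d∣y k = coprime-divisor d⊥n (divides (y (suc k)) (sym (step k)))
    z : ℕ → ℕ
    z k = _∣_.quotient (d∣y k)
    zd : ∀ k → y k ≡ z k ℕ.* d
    zd k = _∣_.equality (d∣y k)
    z-step : ∀ k → z (suc k) ℕ.* d ≡ n ℕ.* z k
    z-step k = ℕ.*-cancelʳ-≡ _ _ d (begin
      z (suc k) ℕ.* d ℕ.* d   ≡⟨ cong (ℕ._* d) (zd (suc k)) ⟨
      y (suc k) ℕ.* d         ≡⟨ step k ⟩
      n ℕ.* y k               ≡⟨ cong (n ℕ.*_) (zd k) ⟩
      n ℕ.* (z k ℕ.* d)       ≡⟨ ℕ.*-assoc n (z k) d ⟨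
      n ℕ.* z k ℕ.* d         ∎)
      where open ≡-Reasoning

  n<m^n : ∀ {m} → 1 ℕ.< m → ∀ n → n ℕ.< m ℕ.^ n
  n<m^n 1<m zero = ℕ.s≤s ℕ.z≤n
  n<m^n {m@(suc _)} 1<m (suc n) = ℕ.≤-<-trans (n<m^n 1<m n)
    (ℕ.^-monoʳ-< m 1<m (ℕ.n<1+n n))

  -- If the denominator d of x were > 1, then dʲ ∣ y₀ for every j.
  geometric-int : ∀ x (y : ℕ → ℤ) → y 0 ≢ + 0 → (∀ k → ι (y (suc k)) ≡ x * ι (y k)) → IsInt x
  geometric-int x y y₀≢0 step with ℚ.↧ₙ x ℕ.≟ 1
  ... | yes d≡1 = denominator≡1⇒int x d≡1
  -- The exponent j = |y₀| already suffices, since dʲ > j for d > 1 while y₀ ≠ 0.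
  ... | no d≢1 = ⊥-elim (ℕ.<⇒≱ (n<m^n 1<d y₀) (∣⇒≤ (power-divides (numerator-coprime x) (λ k → ℤ.∣ y k ∣) step′ y₀)))
    where
    open ≡-Reasoning
    d = ℚ.↧ₙ x
    y₀ = ℤ.∣ y 0 ∣
    instance
      y₀-nonZero : ℕ.NonZero y₀
      y₀-nonZero = ℕ.≢-nonZero (y₀≢0 ∘ ℤ.∣i∣≡0⇒i≡0)
    1<d : 1 ℕ.< d
    1<d = ℕ.≤∧≢⇒< (ℕ.s≤s ℕ.z≤n) (d≢1 ∘ sym)
    cleared : ∀ k → y (suc k) ℤ.* + d ≡ ℚ.↥ x ℤ.* y k
    cleared k = ι-injective (begin
      ι (y (suc k) ℤ.* + d)        ≡⟨ ι-* (y (suc k)) (+ d) ⟩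
      ι (y (suc k)) * ι (+ d)      ≡⟨ cong (_* ι (+ d)) (step k) ⟩
      x * ι (y k) * ι (+ d)        ≡⟨ solve 3 (λ x y d → x :* y :* d := x :* d :* y) refl x (ι (y k)) (ι (+ d)) ⟩
      x * ι (+ d) * ι (y k)        ≡⟨ cong (_* ι (y k)) (*-denominator x) ⟩
      ι (ℚ.↥ x) * ι (y k)          ≡⟨ ι-* (ℚ.↥ x) (y k) ⟨
      ι (ℚ.↥ x ℤ.* y k)            ∎)
    step′ : ∀ k → ℤ.∣ y (suc k) ∣ ℕ.* d ≡ ℤ.∣ ℚ.↥ x ∣ ℕ.* ℤ.∣ y k ∣
    step′ k = trans (sym (ℤ.abs-* (y (suc k)) (+ d))) (trans (cong ℤ.∣_∣ (cleared k)) (ℤ.abs-* (ℚ.↥ x) (y k)))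

  -- Order on the rationals, greatest common divisors and the gap below 1.

  <⇒≱ : ∀ {a b} → a < b → ¬ (b ≤ a)
  <⇒≱ a<b b≤a = ℚ.<-irrefl refl (ℚ.<-≤-trans a<b b≤a)

  ≤-from-difference : ∀ {a b} c → 0ℚ ≤ c → b ≡ a + c → a ≤ b
  ≤-from-difference {a} c 0≤c refl = subst (_≤ a + c) (ℚ.+-identityʳ a) (ℚ.+-monoʳ-≤ a 0≤c)

  difference-nonNeg : ∀ {a b} → a ≤ b → 0ℚ ≤ b - a
  difference-nonNeg {a} {b} a≤b = subst (_≤ b - a) (ℚ.+-inverseʳ a) (ℚ.+-monoˡ-≤ (- a) a≤b)

  *-nonNeg : ∀ {a b} → 0ℚ ≤ a → 0ℚ ≤ b → 0ℚ ≤ a * b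
  *-nonNeg {a} {b} 0≤a 0≤b = subst (_≤ a * b) (ℚ.*-zeroʳ a)
    (ℚ.*-monoˡ-≤-nonNeg a {{ℚ.nonNegative 0≤a}} 0≤b)

  +-nonNeg : ∀ {a b} → 0ℚ ≤ a → 0ℚ ≤ b → 0ℚ ≤ a + b
  +-nonNeg = ℚ.+-mono-≤

  sq-nonNeg : ∀ a → 0ℚ ≤ a * a
  sq-nonNeg a with ℚ.≤-total 0ℚ a
  ... | inj₁ 0≤a = *-nonNeg 0≤a 0≤a
  ... | inj₂ a≤0 = subst (0ℚ ≤_) (solve 1 (λ a → :- a :* :- a := a :* a) refl a) (*-nonNeg 0≤-a 0≤-a)
    where
    0≤-a : 0ℚ ≤ - a
    0≤-a = ℚ.neg-antimono-≤ a≤0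

  bézout-combination : ∀ i p j q g x → g ℕ.+ j ℕ.* q ≡ i ℕ.* p →
            ι (+ i) * (ι (+ p) * x) - ι (+ j) * (ι (+ q) * x) ≡ ι (+ g) * x
  bézout-combination i p j q g x eq = begin
    ι (+ i) * (ι (+ p) * x) - ι (+ j) * (ι (+ q) * x)
      ≡⟨ solve 5 (λ i p j q x → i :* (p :* x) :- j :* (q :* x) := (i :* p) :* x :- j :* q :* x) refl (ι (+ i)) (ι (+ p)) (ι (+ j)) (ι (+ q)) x ⟩
    ι (+ i) * ι (+ p) * x - ι (+ j) * ι (+ q) * x
      ≡⟨ cong (λ t → t * x - ι (+ j) * ι (+ q) * x) ip ⟩
    (ι (+ g) + ι (+ j) * ι (+ q)) * x - ι (+ j) * ι (+ q) * x
      ≡⟨ solve 4 (λ g j q x → (g :+ j :* q) :* x :- j :* q :* x := g :* x) refl (ι (+ g)) (ι (+ j)) (ι (+ q)) x ⟩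
    ι (+ g) * x ∎
    where
    open ≡-Reasoning
    ip : ι (+ i) * ι (+ p) ≡ ι (+ g) + ι (+ j) * ι (+ q)
    ip = begin
      ι (+ i) * ι (+ p)              ≡⟨ ℕ→ℚ-* i p ⟨
      ι (+ (i ℕ.* p))                ≡⟨ cong ℕ→ℚ eq ⟨
      ι (+ (g ℕ.+ j ℕ.* q))          ≡⟨ ι-+ (+ g) (+ (j ℕ.* q)) ⟩
      ι (+ g) + ι (+ (j ℕ.* q))      ≡⟨ cong (λ t → ι (+ g) + t) (ℕ→ℚ-* j q) ⟩
      ι (+ g) + ι (+ j) * ι (+ q)    ∎

  gcd-int : ∀ p q {x} → IsInt (ι (+ p) * x) → IsInt (ι (+ q) * x) → IsInt (ι (+ gcd p q) * x)
  gcd-int p q {x} hp hq with Bézout.identity (gcd-GCD p q)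
  ... | Bézout.+- i j eq = subst IsInt (bézout-combination i p j q (gcd p q) x eq)
    (int-- (int-* (+ i , refl) hp) (int-* (+ j , refl) hq))
  ... | Bézout.-+ i j eq = subst IsInt (bézout-combination j q i p (gcd p q) x eq)
    (int-- (int-* (+ j , refl) hq) (int-* (+ i , refl) hp))

  -- The discreteness of ℤ is what converts size estimates into vanishing: the dichotomy is applied
  -- to 4gd and to b.
  int-square : ∀ {x} → IsInt x → x ≡ 0ℚ ⊎ 1ℚ ≤ x * x
  int-square (+ zero , refl) = inj₁ refl
  int-square (i@(ℤ.+[1+ n ]) , refl) = inj₂ (subst (1ℚ ≤_) (ι-* i i) (ι-mono-≤ {+ 1} {i ℤ.* i} (ℤ.+≤+ (ℕ.s≤s ℕ.z≤n))))
  int-square (i@(ℤ.-[1+ n ]) , refl) = inj₂ (subst (1ℚ ≤_) (ι-* i i) (ι-mono-≤ {+ 1} {i ℤ.* i} (ℤ.+≤+ (ℕ.s≤s ℕ.z≤n))))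

  int-cancel : ∀ n .{{_ : ℕ.NonZero n}} {x} → ι (+ n) * x ≡ 0ℚ → x ≡ 0ℚ
  int-cancel n@(suc _) {x} nx≡0 = begin
    x                        ≡⟨ ℚ.*-identityˡ x ⟨
    1ℚ * x                   ≡⟨ cong (_* x) (suc*mesh (ℕ.pred n)) ⟨
    ι (+ n) * ε * x          ≡⟨ solve 3 (λ n e x → n :* e :* x := e :* (n :* x)) refl (ι (+ n)) ε x ⟩
    ε * (ι (+ n) * x)        ≡⟨ cong (ε *_) nx≡0 ⟩
    ε * 0ℚ                   ≡⟨ ℚ.*-zeroʳ ε ⟩
    0ℚ                       ∎
    where
    open ≡-Reasoning
    ε = mesh (ℕ.pred n)

  -- Products in Biquadratic with polynomial coordinates, as input for the ring solver.
  record Coords (n : ℕ) : Set where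
    constructor ⟪_,_,_,_⟫
    field e₁ e₂ e₃ e₄ : Polynomial n
  open Coords

  times : ∀ {n} → Polynomial n → Polynomial n → Coords n → Coords n → Coords n
  times P Q ⟪ a , b , c , d ⟫ ⟪ a′ , b′ , c′ , d′ ⟫ = ⟪
    a :* a′ :+ P :* (b :* b′) :+ Q :* (c :* c′) :+ P :* Q :* (d :* d′) ,
    a :* b′ :+ b :* a′ :+ Q :* (c :* d′ :+ d :* c′) ,
    a :* c′ :+ c :* a′ :+ P :* (b :* d′ :+ d :* b′) ,
    a :* d′ :+ d :* a′ :+ b :* c′ :+ c :* b′ ⟫

  plus : ∀ {n} → Coords n → Coords n → Coords n
  plus ⟪ a , b , c , d ⟫ ⟪ a′ , b′ , c′ , d′ ⟫ = ⟪ a :+ a′ , b :+ b′ , c :+ c′ , d :+ d′ ⟫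

  -- Ring laws for the biquadratic coordinates.

  module _ {p q : ℕ} where
    private
      K = Biquadratic p q
      P = ι (+ p)
      Q = ι (+ q)

    coords≡ : ∀ {a b c d a′ b′ c′ d′} → a ≡ a′ → b ≡ b′ → c ≡ c′ → d ≡ d′ →
              _≡_ {A = K} ⟨ a , b , c , d ⟩ ⟨ a′ , b′ , c′ , d′ ⟩
    coords≡ refl refl refl refl = refl

    *ᴷ-assoc : (x y z : K) → (x *ᴷ y) *ᴷ z ≡ x *ᴷ (y *ᴷ z)
    *ᴷ-assoc ⟨ a , b , c , d ⟩ ⟨ a′ , b′ , c′ , d′ ⟩ ⟨ a″ , b″ , c″ , d″ ⟩ = coords≡
      (solve 14 (λ P Q a b c d a′ b′ c′ d′ a″ b″ c″ d″ →
        let x = ⟪ a , b , c , d ⟫ ; y = ⟪ a′ , b′ , c′ , d′ ⟫ ; z = ⟪ a″ , b″ , c″ , d″ ⟫ ; _·_ = times P Q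
        in e₁ ((x · y) · z) := e₁ (x · (y · z))) refl P Q a b c d a′ b′ c′ d′ a″ b″ c″ d″)
      (solve 14 (λ P Q a b c d a′ b′ c′ d′ a″ b″ c″ d″ →
        let x = ⟪ a , b , c , d ⟫ ; y = ⟪ a′ , b′ , c′ , d′ ⟫ ; z = ⟪ a″ , b″ , c″ , d″ ⟫ ; _·_ = times P Q
        in e₂ ((x · y) · z) := e₂ (x · (y · z))) refl P Q a b c d a′ b′ c′ d′ a″ b″ c″ d″)
      (solve 14 (λ P Q a b c d a′ b′ c′ d′ a″ b″ c″ d″ →
        let x = ⟪ a , b , c , d ⟫ ; y = ⟪ a′ , b′ , c′ , d′ ⟫ ; z = ⟪ a″ , b″ , c″ , d″ ⟫ ; _·_ = times P Q
        in e₃ ((x · y) · z) := e₃ (x · (y · z))) refl P Q a b c d a′ b′ c′ d′ a″ b″ c″ d″)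
      (solve 14 (λ P Q a b c d a′ b′ c′ d′ a″ b″ c″ d″ →
        let x = ⟪ a , b , c , d ⟫ ; y = ⟪ a′ , b′ , c′ , d′ ⟫ ; z = ⟪ a″ , b″ , c″ , d″ ⟫ ; _·_ = times P Q
        in e₄ ((x · y) · z) := e₄ (x · (y · z))) refl P Q a b c d a′ b′ c′ d′ a″ b″ c″ d″)

    *ᴷ-comm : (x y : K) → x *ᴷ y ≡ y *ᴷ x
    *ᴷ-comm ⟨ a , b , c , d ⟩ ⟨ a′ , b′ , c′ , d′ ⟩ = coords≡
      (solve 10 (λ P Q a b c d a′ b′ c′ d′ →
        let x = ⟪ a , b , c , d ⟫ ; y = ⟪ a′ , b′ , c′ , d′ ⟫ ; _·_ = times P Q
        in e₁ (x · y) := e₁ (y · x)) refl P Q a b c d a′ b′ c′ d′)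
      (solve 10 (λ P Q a b c d a′ b′ c′ d′ →
        let x = ⟪ a , b , c , d ⟫ ; y = ⟪ a′ , b′ , c′ , d′ ⟫ ; _·_ = times P Q
        in e₂ (x · y) := e₂ (y · x)) refl P Q a b c d a′ b′ c′ d′)
      (solve 10 (λ P Q a b c d a′ b′ c′ d′ →
        let x = ⟪ a , b , c , d ⟫ ; y = ⟪ a′ , b′ , c′ , d′ ⟫ ; _·_ = times P Q
        in e₃ (x · y) := e₃ (y · x)) refl P Q a b c d a′ b′ c′ d′)
      (solve 10 (λ P Q a b c d a′ b′ c′ d′ →
        let x = ⟪ a , b , c , d ⟫ ; y = ⟪ a′ , b′ , c′ , d′ ⟫ ; _·_ = times P Q
        in e₄ (x · y) := e₄ (y · x)) refl P Q a b c d a′ b′ c′ d′)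

    *ᴷ-distribʳ-+ᴷ : (z x y : K) → (x +ᴷ y) *ᴷ z ≡ (x *ᴷ z) +ᴷ (y *ᴷ z)
    *ᴷ-distribʳ-+ᴷ ⟨ a , b , c , d ⟩ ⟨ a′ , b′ , c′ , d′ ⟩ ⟨ a″ , b″ , c″ , d″ ⟩ = coords≡
      (solve 14 (λ P Q a b c d a′ b′ c′ d′ a″ b″ c″ d″ →
        let z = ⟪ a , b , c , d ⟫ ; x = ⟪ a′ , b′ , c′ , d′ ⟫ ; y = ⟪ a″ , b″ , c″ , d″ ⟫ ; _·_ = times P Q
        in e₁ (plus x y · z) := e₁ (plus (x · z) (y · z))) refl P Q a b c d a′ b′ c′ d′ a″ b″ c″ d″)
      (solve 14 (λ P Q a b c d a′ b′ c′ d′ a″ b″ c″ d″ →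
        let z = ⟪ a , b , c , d ⟫ ; x = ⟪ a′ , b′ , c′ , d′ ⟫ ; y = ⟪ a″ , b″ , c″ , d″ ⟫ ; _·_ = times P Q
        in e₂ (plus x y · z) := e₂ (plus (x · z) (y · z))) refl P Q a b c d a′ b′ c′ d′ a″ b″ c″ d″)
      (solve 14 (λ P Q a b c d a′ b′ c′ d′ a″ b″ c″ d″ →
        let z = ⟪ a , b , c , d ⟫ ; x = ⟪ a′ , b′ , c′ , d′ ⟫ ; y = ⟪ a″ , b″ , c″ , d″ ⟫ ; _·_ = times P Q
        in e₃ (plus x y · z) := e₃ (plus (x · z) (y · z))) refl P Q a b c d a′ b′ c′ d′ a″ b″ c″ d″)
      (solve 14 (λ P Q a b c d a′ b′ c′ d′ a″ b″ c″ d″ →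
        let z = ⟪ a , b , c , d ⟫ ; x = ⟪ a′ , b′ , c′ , d′ ⟫ ; y = ⟪ a″ , b″ , c″ , d″ ⟫ ; _·_ = times P Q
        in e₄ (plus x y · z) := e₄ (plus (x · z) (y · z))) refl P Q a b c d a′ b′ c′ d′ a″ b″ c″ d″)

    *ᴷ-identityˡ : (x : K) → 1ᴷ *ᴷ x ≡ x
    *ᴷ-identityˡ ⟨ a , b , c , d ⟩ = coords≡
      (solve 6 (λ P Q a b c d → e₁ (times P Q one ⟪ a , b , c , d ⟫) := a) refl P Q a b c d)
      (solve 6 (λ P Q a b c d → e₂ (times P Q one ⟪ a , b , c , d ⟫) := b) refl P Q a b c d)
      (solve 6 (λ P Q a b c d → e₃ (times P Q one ⟪ a , b , c , d ⟫) := c) refl P Q a b c d)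
      (solve 6 (λ P Q a b c d → e₄ (times P Q one ⟪ a , b , c , d ⟫) := d) refl P Q a b c d)
      where
      one : Coords 6
      one = ⟪ con 1ℚ , con 0ℚ , con 0ℚ , con 0ℚ ⟫

    -- Common denominators and almost integrality.

    -- Equivalently, Dx lies in the ℤ-span of 1, √p, √q and √p√q. This span is closed under
    -- multiplication, so denominators multiply under products.
    record Clears (D : ℕ) (x : K) : Set where
      constructor clears
      open Biquadratic x
      field
        clears₁    : IsInt (ℕ→ℚ D * coeff₁)
        clears√p   : IsInt (ℕ→ℚ D * coeff√p)
        clears√q   : IsInt (ℕ→ℚ D * coeff√q)
        clears√p√q : IsInt (ℕ→ℚ D * coeff√p√q)

    clears-* : ∀ {D E x y} → Clears D x → Clears E y → Clears (D ℕ.* E) (x *ᴷ y)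
    clears-* {D} {E} {⟨ a , b , c , d ⟩} {⟨ a′ , b′ , c′ , d′ ⟩} (clears ha hb hc hd) (clears ha′ hb′ hc′ hd′) =
      clears (entry
        (solve 12 (λ P Q D E a b c d a′ b′ c′ d′ →
          let x = ⟪ a , b , c , d ⟫ ; y = ⟪ a′ , b′ , c′ , d′ ⟫
          in e₁ (times P Q (scaled D x) (scaled E y)) := D :* E :* e₁ (times P Q x y))
          refl P Q (ℕ→ℚ D) (ℕ→ℚ E) a b c d a′ b′ c′ d′)
        (int-+ (int-+ (int-+ (int-* ha ha′) (int-* hP (int-* hb hb′))) (int-* hQ (int-* hc hc′)))
          (int-* (int-* hP hQ) (int-* hd hd′))))
      (entry
        (solve 12 (λ P Q D E a b c d a′ b′ c′ d′ →
          let x = ⟪ a , b , c , d ⟫ ; y = ⟪ a′ , b′ , c′ , d′ ⟫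
          in e₂ (times P Q (scaled D x) (scaled E y)) := D :* E :* e₂ (times P Q x y))
          refl P Q (ℕ→ℚ D) (ℕ→ℚ E) a b c d a′ b′ c′ d′)
        (int-+ (int-+ (int-* ha hb′) (int-* hb ha′)) (int-* hQ (int-+ (int-* hc hd′) (int-* hd hc′)))))
      (entry
        (solve 12 (λ P Q D E a b c d a′ b′ c′ d′ →
          let x = ⟪ a , b , c , d ⟫ ; y = ⟪ a′ , b′ , c′ , d′ ⟫
          in e₃ (times P Q (scaled D x) (scaled E y)) := D :* E :* e₃ (times P Q x y))
          refl P Q (ℕ→ℚ D) (ℕ→ℚ E) a b c d a′ b′ c′ d′)
        (int-+ (int-+ (int-* ha hc′) (int-* hc ha′)) (int-* hP (int-+ (int-* hb hd′) (int-* hd hb′)))))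
      (entry
        (solve 12 (λ P Q D E a b c d a′ b′ c′ d′ →
          let x = ⟪ a , b , c , d ⟫ ; y = ⟪ a′ , b′ , c′ , d′ ⟫
          in e₄ (times P Q (scaled D x) (scaled E y)) := D :* E :* e₄ (times P Q x y))
          refl P Q (ℕ→ℚ D) (ℕ→ℚ E) a b c d a′ b′ c′ d′)
        (int-+ (int-+ (int-+ (int-* ha hd′) (int-* hd ha′)) (int-* hb hc′)) (int-* hc hb′)))
      where
      entry : ∀ {s t} → s ≡ ℕ→ℚ D * ℕ→ℚ E * t → IsInt s → IsInt (ℕ→ℚ (D ℕ.* E) * t)
      entry {t = t} eq = subst IsInt (trans eq (cong (_* t) (sym (ℕ→ℚ-* D E))))
      scaled : ∀ {n} → Polynomial n → Coords n → Coords n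
      scaled D ⟪ a , b , c , d ⟫ = ⟪ D :* a , D :* b , D :* c , D :* d ⟫
      hP : IsInt P
      hP = + p , refl
      hQ : IsInt Q
      hQ = + q , refl

    clears-+ : ∀ {D x y} → Clears D x → Clears D y → Clears D (x +ᴷ y)
    clears-+ {D} {⟨ a , b , c , d ⟩} {⟨ a′ , b′ , c′ , d′ ⟩} (clears ha hb hc hd) (clears ha′ hb′ hc′ hd′) =
      clears (add a a′ ha ha′) (add b b′ hb hb′) (add c c′ hc hc′) (add d d′ hd hd′)
      where
      add : ∀ a a′ → IsInt (ℕ→ℚ D * a) → IsInt (ℕ→ℚ D * a′) → IsInt (ℕ→ℚ D * (a + a′))
      add a a′ ha ha′ = subst IsInt (sym (ℚ.*-distribˡ-+ (ℕ→ℚ D) a a′)) (int-+ ha ha′)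

    clears-cancelˡ : ∀ {D x y} → Clears D x → Clears D (x +ᴷ y) → Clears D y
    clears-cancelˡ {D} {⟨ a , b , c , d ⟩} {⟨ a′ , b′ , c′ , d′ ⟩} (clears ha hb hc hd) (clears ha′ hb′ hc′ hd′) =
      clears (cancel a a′ ha ha′) (cancel b b′ hb hb′) (cancel c c′ hc hc′) (cancel d d′ hd hd′)
      where
      cancel : ∀ a a′ → IsInt (ℕ→ℚ D * a) → IsInt (ℕ→ℚ D * (a + a′)) → IsInt (ℕ→ℚ D * a′)
      cancel a a′ ha ha+a′ = subst IsInt
        (solve 3 (λ D a a′ → D :* (a :+ a′) :- D :* a := D :* a′) refl (ℕ→ℚ D) a a′) (int-- ha+a′ ha)

    clears-multiple : ∀ D {E x} → Clears E x → Clears (D ℕ.* E) x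
    clears-multiple D {E} {⟨ a , b , c , d ⟩} (clears ha hb hc hd) =
      clears (int-multiple a D E ha) (int-multiple b D E hb) (int-multiple c D E hc) (int-multiple d D E hd)

    common-denominator : ∀ x → ∃[ D ] (ℕ.NonZero D × Clears D x)
    common-denominator ⟨ a , b , c , d ⟩ =
      A ℕ.* (B ℕ.* (C ℕ.* D)) , _ , clears
        (right a A (B ℕ.* (C ℕ.* D)) (clear a))
        (left b A (B ℕ.* (C ℕ.* D)) (right b B (C ℕ.* D) (clear b)))
        (left c A (B ℕ.* (C ℕ.* D)) (left c B (C ℕ.* D) (right c C D (clear c))))
        (left d A (B ℕ.* (C ℕ.* D)) (left d B (C ℕ.* D) (left d C D (clear d))))
      where
      A = ℚ.↧ₙ a
      B = ℚ.↧ₙ b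
      C = ℚ.↧ₙ c
      D = ℚ.↧ₙ d
      clear : ∀ a → IsInt (ℕ→ℚ (ℚ.↧ₙ a) * a)
      clear a = ℚ.↥ a , trans (ℚ.*-comm (ℕ→ℚ (ℚ.↧ₙ a)) a) (*-denominator a)
      left = int-multiple
      right : ∀ a D E → IsInt (ℕ→ℚ D * a) → IsInt (ℕ→ℚ (D ℕ.* E) * a)
      right a D E ha = subst (λ n → IsInt (ℕ→ℚ n * a)) (ℕ.*-comm E D) (left a E D ha)

    infixr 8 _^ᴷ_

    _^ᴷ_ : K → ℕ → K
    x ^ᴷ zero  = 1ᴷ
    x ^ᴷ suc k = x *ᴷ x ^ᴷ k

    clears-1 : ∀ D → Clears D 1ᴷ
    clears-1 D = clears (int-* (+ D , refl) (+ 1 , refl)) zeroed zeroed zeroed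
      where
      zeroed : IsInt (ℕ→ℚ D * 0ℚ)
      zeroed = int-* (+ D , refl) (+ 0 , refl)

    initial-powers : ∀ α n → ∃[ D ] (ℕ.NonZero D × (∀ i → i ℕ.≤ n → Clears D (α ^ᴷ i)))
    initial-powers α zero = 1 , _ , λ { zero ℕ.z≤n → clears-1 1 }
    initial-powers α (suc n) =
      let D , D≢0 , h = initial-powers α n
          E , E≢0 , h′ = common-denominator (α ^ᴷ suc n)
      in E ℕ.* D , ℕ.m*n≢0 E D {{E≢0}} {{D≢0}} , λ i i≤1+n → extend h h′ (ℕ.m≤n⇒m<n∨m≡n i≤1+n)
      where
      extend : ∀ {D E i} → (∀ i → i ℕ.≤ n → Clears D (α ^ᴷ i)) → Clears E (α ^ᴷ suc n) →
               i ℕ.< suc n ⊎ i ≡ suc n → Clears (E ℕ.* D) (α ^ᴷ i)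
      extend {E = E} h h′ (inj₁ (ℕ.s≤s i≤n)) = clears-multiple E (h _ i≤n)
      extend {D} {E} h h′ (inj₂ refl) = subst (λ m → Clears m (α ^ᴷ suc n)) (ℕ.*-comm D E) (clears-multiple D h′)

    -- By monicity the leading term is the whole value minus lower terms that D clears. The factor β
    -- absorbs the powers of α released by Horner's scheme: (c + αe)β = cβ + e(αβ), so the recursion
    -- continues with αβ in place of β.
    clears-top : ∀ {D} cs α β → (∀ i → i ℕ.< length cs → Clears D (α ^ᴷ i *ᴷ β)) →
                 Clears D (evalMonic cs α *ᴷ β) → Clears D (α ^ᴷ length cs *ᴷ β)
    clears-top []       α β lower whole = whole
    clears-top {D} (c ∷ cs) α β lower whole = subst (Clears D) (shift (length cs))
      (clears-top cs α (α *ᴷ β)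
        (λ i i<n → subst (Clears D) (sym (shift i)) (lower (suc i) (ℕ.s≤s i<n)))
        (clears-cancelˡ cβ (subst (Clears D) expand whole)))
      where
      open ≡-Reasoning
      e = evalMonic cs α

      shift : ∀ i → α ^ᴷ i *ᴷ (α *ᴷ β) ≡ α ^ᴷ suc i *ᴷ β
      shift i = trans (sym (*ᴷ-assoc (α ^ᴷ i) α β)) (cong (_*ᴷ β) (*ᴷ-comm (α ^ᴷ i) α))

      expand : (ℤ→ᴷ c +ᴷ α *ᴷ e) *ᴷ β ≡ ℤ→ᴷ c *ᴷ β +ᴷ e *ᴷ (α *ᴷ β)
      expand = begin
        (ℤ→ᴷ c +ᴷ α *ᴷ e) *ᴷ β             ≡⟨ *ᴷ-distribʳ-+ᴷ β (ℤ→ᴷ c) (α *ᴷ e) ⟩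
        ℤ→ᴷ c *ᴷ β +ᴷ α *ᴷ e *ᴷ β          ≡⟨ cong (λ t → ℤ→ᴷ c *ᴷ β +ᴷ t *ᴷ β) (*ᴷ-comm α e) ⟩
        ℤ→ᴷ c *ᴷ β +ᴷ e *ᴷ α *ᴷ β          ≡⟨ cong (ℤ→ᴷ c *ᴷ β +ᴷ_) (*ᴷ-assoc e α β) ⟩
        ℤ→ᴷ c *ᴷ β +ᴷ e *ᴷ (α *ᴷ β)        ∎

      cβ : Clears D (ℤ→ᴷ c *ᴷ β)
      cβ = subst (λ E → Clears E (ℤ→ᴷ c *ᴷ β)) (ℕ.*-identityˡ D)
        (clears-* (clears-ℤ c) (subst (Clears D) (*ᴷ-identityˡ β) (lower 0 (ℕ.s≤s ℕ.z≤n))))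
        where
        clears-ℤ : ∀ c → Clears 1 (ℤ→ᴷ c)
        clears-ℤ c = clears (int-* (+ 1 , refl) (c , refl)) (+ 0 , refl) (+ 0 , refl) (+ 0 , refl)

    AlmostIntegral : K → Set
    AlmostIntegral α = ∃[ D ] (ℕ.NonZero D × (∀ k → Clears D (α ^ᴷ k)))

    integral⇒almostIntegral : ∀ {α} → 𝒪 p q α → AlmostIntegral α
    integral⇒almostIntegral {α} (cs , root) =
      let D , D≢0 , initial = initial-powers α n
      in D , D≢0 , λ k → subst (Clears D) (*ᴷ-identityˡ (α ^ᴷ k)) (window initial k 0 ℕ.z≤n)
      where
      n = length cs

      annihilated : ∀ {D} β → Clears D (evalMonic cs α *ᴷ β)
      annihilated {D} ⟨ a , b , c , d ⟩ = subst (Clears D)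
        (trans (sym zero*) (cong (_*ᴷ ⟨ a , b , c , d ⟩) (sym root)))
        (clears zeroed zeroed zeroed zeroed)
        where
        zeroed : IsInt (ℕ→ℚ D * 0ℚ)
        zeroed = int-* (+ D , refl) (+ 0 , refl)
        zero* : 0ᴷ *ᴷ ⟨ a , b , c , d ⟩ ≡ ⟨ 0ℚ , 0ℚ , 0ℚ , 0ℚ ⟩
        zero* = coords≡
          (solve 6 (λ P Q a b c d → e₁ (times P Q nought ⟪ a , b , c , d ⟫) := con 0ℚ) refl P Q a b c d)
          (solve 6 (λ P Q a b c d → e₂ (times P Q nought ⟪ a , b , c , d ⟫) := con 0ℚ) refl P Q a b c d)
          (solve 6 (λ P Q a b c d → e₃ (times P Q nought ⟪ a , b , c , d ⟫) := con 0ℚ) refl P Q a b c d)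
          (solve 6 (λ P Q a b c d → e₄ (times P Q nought ⟪ a , b , c , d ⟫) := con 0ℚ) refl P Q a b c d)
          where
          nought : Coords 6
          nought = ⟪ con 0ℚ , con 0ℚ , con 0ℚ , con 0ℚ ⟫

      -- The invariant at k is that D clears the n + 1 consecutive powers from αᵏ to αᵏ⁺ⁿ. Raising k
      -- by one keeps all but the lowest; the new top power αⁿαᵏ⁺¹ comes from the polynomial
      -- relation multiplied by αᵏ⁺¹. Thus the denominator never grows beyond the one for the
      -- initial window.
      window : ∀ {D} → (∀ i → i ℕ.≤ n → Clears D (α ^ᴷ i)) →
               ∀ k i → i ℕ.≤ n → Clears D (α ^ᴷ i *ᴷ α ^ᴷ k)
      window {D} initial zero i i≤n = subst (Clears D) (sym (trans (*ᴷ-comm (α ^ᴷ i) 1ᴷ) (*ᴷ-identityˡ (α ^ᴷ i)))) (initial i i≤n)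
      window {D} initial (suc k) i i≤n with ℕ.m≤n⇒m<n∨m≡n i≤n
      ... | inj₁ i<n = subst (Clears D)
          (trans (cong (_*ᴷ α ^ᴷ k) (*ᴷ-comm α (α ^ᴷ i))) (*ᴷ-assoc (α ^ᴷ i) α (α ^ᴷ k)))
          (window initial k (suc i) i<n)
      ... | inj₂ refl = clears-top cs α (α ^ᴷ suc k) below (annihilated (α ^ᴷ suc k))
        where
        below : ∀ i → i ℕ.< n → Clears D (α ^ᴷ i *ᴷ α ^ᴷ suc k)
        below i i<n = subst (Clears D)
          (trans (cong (_*ᴷ α ^ᴷ k) (*ᴷ-comm α (α ^ᴷ i))) (*ᴷ-assoc (α ^ᴷ i) α (α ^ᴷ k)))
          (window initial k (suc i) i<n)

    *ᴷ-interchange : (w x y z : K) → (w *ᴷ x) *ᴷ (y *ᴷ z) ≡ (w *ᴷ y) *ᴷ (x *ᴷ z)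
    *ᴷ-interchange w x y z = begin
      (w *ᴷ x) *ᴷ (y *ᴷ z)     ≡⟨ *ᴷ-assoc w x (y *ᴷ z) ⟩
      w *ᴷ (x *ᴷ (y *ᴷ z))     ≡⟨ cong (w *ᴷ_) (*ᴷ-assoc x y z) ⟨
      w *ᴷ (x *ᴷ y *ᴷ z)       ≡⟨ cong (λ t → w *ᴷ (t *ᴷ z)) (*ᴷ-comm x y) ⟩
      w *ᴷ (y *ᴷ x *ᴷ z)       ≡⟨ cong (w *ᴷ_) (*ᴷ-assoc y x z) ⟩
      w *ᴷ (y *ᴷ (x *ᴷ z))     ≡⟨ *ᴷ-assoc w y (x *ᴷ z) ⟨
      (w *ᴷ y) *ᴷ (x *ᴷ z)     ∎
      where open ≡-Reasoning

    almostIntegral-* : ∀ {α β} → AlmostIntegral α → AlmostIntegral β → AlmostIntegral (α *ᴷ β)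
    almostIntegral-* {α} {β} (D , D≢0 , hα) (E , E≢0 , hβ) =
      D ℕ.* E , ℕ.m*n≢0 D E {{D≢0}} {{E≢0}} , λ k →
        subst (Clears (D ℕ.* E)) (sym (^-distrib k)) (clears-* (hα k) (hβ k))
      where
      ^-distrib : ∀ k → (α *ᴷ β) ^ᴷ k ≡ α ^ᴷ k *ᴷ β ^ᴷ k
      ^-distrib zero    = sym (*ᴷ-identityˡ 1ᴷ)
      ^-distrib (suc k) = trans (cong ((α *ᴷ β) *ᴷ_) (^-distrib k)) (*ᴷ-interchange α β (α ^ᴷ k) (β ^ᴷ k))

    almostIntegral-+ : ∀ {α β} → AlmostIntegral α → AlmostIntegral β → AlmostIntegral (α +ᴷ β)
    almostIntegral-+ {α} {β} (D , D≢0 , hα) (E , E≢0 , hβ) =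
      D ℕ.* E , ℕ.m*n≢0 D E {{D≢0}} {{E≢0}} , λ k →
        subst (Clears (D ℕ.* E)) (strip ((α +ᴷ β) ^ᴷ k)) (mixed k 0 0)
      where
      open ≡-Reasoning
      strip : ∀ x → x *ᴷ (1ᴷ *ᴷ 1ᴷ) ≡ x
      strip x = trans (*ᴷ-comm x (1ᴷ *ᴷ 1ᴷ)) (trans (*ᴷ-assoc 1ᴷ 1ᴷ x) (trans (*ᴷ-identityˡ (1ᴷ *ᴷ x)) (*ᴷ-identityˡ x)))
      -- The monomials αⁱβʲ are carried along so that the factors α + β can be expanded one at a
      -- time, without binomial coefficients; at the end every summand is a monomial cleared by DE.
      mixed : ∀ k i j → Clears (D ℕ.* E) ((α +ᴷ β) ^ᴷ k *ᴷ (α ^ᴷ i *ᴷ β ^ᴷ j))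
      mixed zero i j = subst (Clears (D ℕ.* E)) (sym (*ᴷ-identityˡ (α ^ᴷ i *ᴷ β ^ᴷ j))) (clears-* (hα i) (hβ j))
      mixed (suc k) i j = subst (Clears (D ℕ.* E)) (sym expand) (clears-+ (mixed k (suc i) j) (mixed k i (suc j)))
        where
        s = (α +ᴷ β) ^ᴷ k
        m = α ^ᴷ i *ᴷ β ^ᴷ j
        expand : (α +ᴷ β) *ᴷ s *ᴷ m ≡ s *ᴷ (α ^ᴷ suc i *ᴷ β ^ᴷ j) +ᴷ s *ᴷ (α ^ᴷ i *ᴷ β ^ᴷ suc j)
        expand = begin
          (α +ᴷ β) *ᴷ s *ᴷ m                        ≡⟨ *ᴷ-assoc (α +ᴷ β) s m ⟩
          (α +ᴷ β) *ᴷ (s *ᴷ m)                      ≡⟨ *ᴷ-distribʳ-+ᴷ (s *ᴷ m) α β ⟩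
          α *ᴷ (s *ᴷ m) +ᴷ β *ᴷ (s *ᴷ m)            ≡⟨ cong₂ _+ᴷ_ (pull α) (pull β) ⟩
          s *ᴷ (α *ᴷ m) +ᴷ s *ᴷ (β *ᴷ m)            ≡⟨ cong₂ (λ x y → s *ᴷ x +ᴷ s *ᴷ y)
                                                        (sym (*ᴷ-assoc α (α ^ᴷ i) (β ^ᴷ j))) (swap β (α ^ᴷ i) (β ^ᴷ j)) ⟩
          s *ᴷ (α ^ᴷ suc i *ᴷ β ^ᴷ j) +ᴷ s *ᴷ (α ^ᴷ i *ᴷ β ^ᴷ suc j) ∎
          where
          swap : ∀ x y z → x *ᴷ (y *ᴷ z) ≡ y *ᴷ (x *ᴷ z)
          swap x y z = trans (sym (*ᴷ-assoc x y z)) (trans (cong (_*ᴷ z) (*ᴷ-comm x y)) (*ᴷ-assoc y x z))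
          pull : ∀ x → x *ᴷ (s *ᴷ m) ≡ s *ᴷ (x *ᴷ m)
          pull x = swap x s m

    almostIntegral-order : ∀ {α} → Clears 1 α → AlmostIntegral α
    almostIntegral-order {α} hα = 1 , _ , powers
      where
      powers : ∀ k → Clears 1 (α ^ᴷ k)
      powers zero    = clears-1 1
      powers (suc k) = clears-* hα (powers k)

    -- The integers Dxᵏ form a geometric sequence of ratio x that starts at D ≠ 0.
    almostIntegral-ℚ : ∀ {x} → AlmostIntegral ⟨ x , 0ℚ , 0ℚ , 0ℚ ⟩ → IsInt x
    almostIntegral-ℚ {x} (D , D≢0 , h) = geometric-int x y y₀≢0 step
      where
      open ≡-Reasoning
      open Clears
      open Biquadratic
      α : K
      α = ⟨ x , 0ℚ , 0ℚ , 0ℚ ⟩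
      y : ℕ → ℤ
      y k = proj₁ (clears₁ (h k))
      ιy : ∀ k → ℕ→ℚ D * coeff₁ (α ^ᴷ k) ≡ ι (y k)
      ιy k = proj₂ (clears₁ (h k))
      y₀≡D : y 0 ≡ + D
      y₀≡D = ι-injective (trans (sym (ιy 0)) (ℚ.*-identityʳ (ℕ→ℚ D)))
      y₀≢0 : y 0 ≢ + 0
      y₀≢0 y₀≡0 = ℕ.≢-nonZero⁻¹ D {{D≢0}} (ℤ.+-injective (trans (sym y₀≡D) y₀≡0))
      step : ∀ k → ι (y (suc k)) ≡ x * ι (y k)
      step k = begin
        ι (y (suc k))                          ≡⟨ ιy (suc k) ⟨
        ℕ→ℚ D * coeff₁ (α *ᴷ α ^ᴷ k)           ≡⟨ first (ℕ→ℚ D) (α ^ᴷ k) ⟩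
        x * (ℕ→ℚ D * coeff₁ (α ^ᴷ k))          ≡⟨ cong (x *_) (ιy k) ⟩
        x * ι (y k)                            ∎
        where
        first : ∀ D β → D * coeff₁ (α *ᴷ β) ≡ x * (D * coeff₁ β)
        first D ⟨ a , b , c , d ⟩ = solve 8 (λ P Q D x a b c d →
          D :* e₁ (times P Q ⟪ x , con 0ℚ , con 0ℚ , con 0ℚ ⟫ ⟪ a , b , c , d ⟫) := x :* (D :* a))
          refl P Q D x a b c d

    -- Conjugations.

    conj√p conj√q : K → K
    conj√p ⟨ a , b , c , d ⟩ = ⟨ a , - b , c , - d ⟩
    conj√q ⟨ a , b , c , d ⟩ = ⟨ a , b , - c , - d ⟩

    conj√p-* : ∀ x y → conj√p (x *ᴷ y) ≡ conj√p x *ᴷ conj√p y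
    conj√p-* ⟨ a , b , c , d ⟩ ⟨ a′ , b′ , c′ , d′ ⟩ = coords≡
      (solve 10 (λ P Q a b c d a′ b′ c′ d′ →
        e₁ (conj (times P Q ⟪ a , b , c , d ⟫ ⟪ a′ , b′ , c′ , d′ ⟫)) :=
          e₁ (times P Q (conj ⟪ a , b , c , d ⟫) (conj ⟪ a′ , b′ , c′ , d′ ⟫)))
        refl P Q a b c d a′ b′ c′ d′)
      (solve 10 (λ P Q a b c d a′ b′ c′ d′ →
        e₂ (conj (times P Q ⟪ a , b , c , d ⟫ ⟪ a′ , b′ , c′ , d′ ⟫)) :=
          e₂ (times P Q (conj ⟪ a , b , c , d ⟫) (conj ⟪ a′ , b′ , c′ , d′ ⟫)))
        refl P Q a b c d a′ b′ c′ d′)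
      (solve 10 (λ P Q a b c d a′ b′ c′ d′ →
        e₃ (conj (times P Q ⟪ a , b , c , d ⟫ ⟪ a′ , b′ , c′ , d′ ⟫)) :=
          e₃ (times P Q (conj ⟪ a , b , c , d ⟫) (conj ⟪ a′ , b′ , c′ , d′ ⟫)))
        refl P Q a b c d a′ b′ c′ d′)
      (solve 10 (λ P Q a b c d a′ b′ c′ d′ →
        e₄ (conj (times P Q ⟪ a , b , c , d ⟫ ⟪ a′ , b′ , c′ , d′ ⟫)) :=
          e₄ (times P Q (conj ⟪ a , b , c , d ⟫) (conj ⟪ a′ , b′ , c′ , d′ ⟫)))
        refl P Q a b c d a′ b′ c′ d′)
      where
      conj : ∀ {n} → Coords n → Coords n
      conj ⟪ a , b , c , d ⟫ = ⟪ a , :- b , c , :- d ⟫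

    conj√q-* : ∀ x y → conj√q (x *ᴷ y) ≡ conj√q x *ᴷ conj√q y
    conj√q-* ⟨ a , b , c , d ⟩ ⟨ a′ , b′ , c′ , d′ ⟩ = coords≡
      (solve 10 (λ P Q a b c d a′ b′ c′ d′ →
        e₁ (conj (times P Q ⟪ a , b , c , d ⟫ ⟪ a′ , b′ , c′ , d′ ⟫)) :=
          e₁ (times P Q (conj ⟪ a , b , c , d ⟫) (conj ⟪ a′ , b′ , c′ , d′ ⟫)))
        refl P Q a b c d a′ b′ c′ d′)
      (solve 10 (λ P Q a b c d a′ b′ c′ d′ →
        e₂ (conj (times P Q ⟪ a , b , c , d ⟫ ⟪ a′ , b′ , c′ , d′ ⟫)) :=
          e₂ (times P Q (conj ⟪ a , b , c , d ⟫) (conj ⟪ a′ , b′ , c′ , d′ ⟫)))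
        refl P Q a b c d a′ b′ c′ d′)
      (solve 10 (λ P Q a b c d a′ b′ c′ d′ →
        e₃ (conj (times P Q ⟪ a , b , c , d ⟫ ⟪ a′ , b′ , c′ , d′ ⟫)) :=
          e₃ (times P Q (conj ⟪ a , b , c , d ⟫) (conj ⟪ a′ , b′ , c′ , d′ ⟫)))
        refl P Q a b c d a′ b′ c′ d′)
      (solve 10 (λ P Q a b c d a′ b′ c′ d′ →
        e₄ (conj (times P Q ⟪ a , b , c , d ⟫ ⟪ a′ , b′ , c′ , d′ ⟫)) :=
          e₄ (times P Q (conj ⟪ a , b , c , d ⟫) (conj ⟪ a′ , b′ , c′ , d′ ⟫)))
        refl P Q a b c d a′ b′ c′ d′)
      where
      conj : ∀ {n} → Coords n → Coords n
      conj ⟪ a , b , c , d ⟫ = ⟪ a , b , :- c , :- d ⟫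

    private
      int-*-neg : ∀ D a → IsInt (D * a) → IsInt (D * - a)
      int-*-neg D a h = subst IsInt (ℚ.neg-distribʳ-* D a) (int-neg h)

    module _ (conj : K → K) (conj-1 : conj 1ᴷ ≡ 1ᴷ) (conj-* : ∀ x y → conj (x *ᴷ y) ≡ conj x *ᴷ conj y)
             (clears-conj : ∀ {D x} → Clears D x → Clears D (conj x)) where

      almostIntegral-conj : ∀ {α} → AlmostIntegral α → AlmostIntegral (conj α)
      almostIntegral-conj {α} (D , D≢0 , h) = D , D≢0 , λ k → subst (Clears D) (conj-^ k) (clears-conj (h k))
        where
        conj-^ : ∀ k → conj (α ^ᴷ k) ≡ conj α ^ᴷ k
        conj-^ zero    = conj-1
        conj-^ (suc k) = trans (conj-* α (α ^ᴷ k)) (cong (conj α *ᴷ_) (conj-^ k))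

    almostIntegral-conj√p : ∀ {α} → AlmostIntegral α → AlmostIntegral (conj√p α)
    almostIntegral-conj√p = almostIntegral-conj conj√p refl conj√p-* clears-conj
      where
      clears-conj : ∀ {D x} → Clears D x → Clears D (conj√p x)
      clears-conj {D} {⟨ a , b , c , d ⟩} (clears ha hb hc hd) =
        clears ha (int-*-neg (ℕ→ℚ D) b hb) hc (int-*-neg (ℕ→ℚ D) d hd)

    almostIntegral-conj√q : ∀ {α} → AlmostIntegral α → AlmostIntegral (conj√q α)
    almostIntegral-conj√q = almostIntegral-conj conj√q refl conj√q-* clears-conj
      where
      clears-conj : ∀ {D x} → Clears D x → Clears D (conj√q x)
      clears-conj {D} {⟨ a , b , c , d ⟩} (clears ha hb hc hd) =
        clears ha hb (int-*-neg (ℕ→ℚ D) c hc) (int-*-neg (ℕ→ℚ D) d hd)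

  square≤0⇒≡0 : ∀ {a} → a * a ≤ 0ℚ → a ≡ 0ℚ
  square≤0⇒≡0 {a} a²≤0 with ℚ.<-cmp a 0ℚ
  ... | tri≈ _ a≡0 _ = a≡0
  ... | tri> _ _ a>0 = ⊥-elim (<⇒≱ (*-pos a>0 a>0) a²≤0)
  ... | tri< a<0 _ _ = ⊥-elim (<⇒≱ (*-pos -a>0 -a>0) (subst (_≤ 0ℚ) (solve 1 (λ a → a :* a := :- a :* :- a) refl a) a²≤0))
    where
    -a>0 : 0ℚ < - a
    -a>0 = ℚ.neg-antimono-< a<0

  -- From traces and norms to integral coordinates.

  half-int : ∀ {x} → (∃[ z ] (x + x ≡ ι z × Even z)) → IsInt x
  half-int {x} (z , 2x≡z , k , refl) = k , (begin
    x                    ≡⟨ solve 1 (λ x → x := con ½ :* (x :+ x)) refl x ⟩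
    ½ * (x + x)          ≡⟨ cong (½ *_) (trans 2x≡z (ι-* (+ 2) k)) ⟩
    ½ * (ι (+ 2) * ι k)  ≡⟨ solve 1 (λ k → con ½ :* (con (ι (+ 2)) :* k) := k) refl (ι k) ⟩
    ι k                  ∎)
    where open ≡-Reasoning

  -- The number n(2y)² = (2x)² - 4(x² - ny²) is an integer, and n is square-free.
  norm⇒double-int : ∀ {n x y} → SquareFree n → IsInt (x + x) → IsInt (x * x - ι (+ n) * (y * y)) → IsInt (y + y)
  norm⇒double-int {n} {x} {y} n-sf 2x∈ℤ N∈ℤ = squareFree-int (y + y) n-sf (subst IsInt
    (solve 3 (λ n x y → (x :+ x) :* (x :+ x) :- con (ι (+ 4)) :* (x :* x :- n :* (y :* y)) :=
                        n :* ((y :+ y) :* (y :+ y))) refl (ι (+ n)) x y)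
    (int-- (int-* 2x∈ℤ 2x∈ℤ) (int-* (+ 4 , refl) N∈ℤ)))


  module _ {p q : ℕ} where
    private
      K = Biquadratic p q
      P = ι (+ p)
      Q = ι (+ q)

    trace-norm-√p : ∀ {x y} → AlmostIntegral {p} {q} ⟨ x , y , 0ℚ , 0ℚ ⟩ →
                    IsInt (x + x) × IsInt (x * x - P * (y * y))
    trace-norm-√p {x} {y} h =
      almostIntegral-ℚ (subst AlmostIntegral trace (almostIntegral-+ h h̄)) ,
      almostIntegral-ℚ (subst AlmostIntegral norm (almostIntegral-* h h̄))
      where
      β : K
      β = ⟨ x , y , 0ℚ , 0ℚ ⟩
      h̄ : AlmostIntegral (conj√p β)
      h̄ = almostIntegral-conj√p h
      trace : β +ᴷ conj√p β ≡ ⟨ x + x , 0ℚ , 0ℚ , 0ℚ ⟩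
      trace = coords≡ refl (ℚ.+-inverseʳ y) refl refl
      norm : β *ᴷ conj√p β ≡ ⟨ x * x - P * (y * y) , 0ℚ , 0ℚ , 0ℚ ⟩
      norm = coords≡
        (solve 4 (λ P Q x y → e₁ (β·β̄ P Q x y) := x :* x :- P :* (y :* y)) refl P Q x y)
        (solve 4 (λ P Q x y → e₂ (β·β̄ P Q x y) := con 0ℚ) refl P Q x y)
        (solve 4 (λ P Q x y → e₃ (β·β̄ P Q x y) := con 0ℚ) refl P Q x y)
        (solve 4 (λ P Q x y → e₄ (β·β̄ P Q x y) := con 0ℚ) refl P Q x y)
        where
        β·β̄ : ∀ {n} → (P Q x y : Polynomial n) → Coords n
        β·β̄ P Q x y = times P Q ⟪ x , y , con 0ℚ , con 0ℚ ⟫ ⟪ x , :- y , con 0ℚ , con 0ℚ ⟫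

    trace-norm-√q : ∀ {x y} → AlmostIntegral {p} {q} ⟨ x , 0ℚ , y , 0ℚ ⟩ →
                    IsInt (x + x) × IsInt (x * x - Q * (y * y))
    trace-norm-√q {x} {y} h =
      almostIntegral-ℚ (subst AlmostIntegral trace (almostIntegral-+ h h̄)) ,
      almostIntegral-ℚ (subst AlmostIntegral norm (almostIntegral-* h h̄))
      where
      β : K
      β = ⟨ x , 0ℚ , y , 0ℚ ⟩
      h̄ : AlmostIntegral (conj√q β)
      h̄ = almostIntegral-conj√q h
      trace : β +ᴷ conj√q β ≡ ⟨ x + x , 0ℚ , 0ℚ , 0ℚ ⟩
      trace = coords≡ refl refl (ℚ.+-inverseʳ y) refl
      norm : β *ᴷ conj√q β ≡ ⟨ x * x - Q * (y * y) , 0ℚ , 0ℚ , 0ℚ ⟩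
      norm = coords≡
        (solve 4 (λ P Q x y → e₁ (β·β̄ P Q x y) := x :* x :- Q :* (y :* y)) refl P Q x y)
        (solve 4 (λ P Q x y → e₂ (β·β̄ P Q x y) := con 0ℚ) refl P Q x y)
        (solve 4 (λ P Q x y → e₃ (β·β̄ P Q x y) := con 0ℚ) refl P Q x y)
        (solve 4 (λ P Q x y → e₄ (β·β̄ P Q x y) := con 0ℚ) refl P Q x y)
        where
        β·β̄ : ∀ {n} → (P Q x y : Polynomial n) → Coords n
        β·β̄ P Q x y = times P Q ⟪ x , con 0ℚ , y , con 0ℚ ⟫ ⟪ x , con 0ℚ , :- y , con 0ℚ ⟫

    private
      four-fold : ∀ n d → n * d + n * d + (n * d + n * d) ≡ n * (d + d + (d + d))
      four-fold = solve 2 (λ n d → n :* d :+ n :* d :+ (n :* d :+ n :* d) := n :* (d :+ d :+ (d :+ d))) refl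

    -- The trace of √p α down to ℚ(√q) is 2pb + 2pd√q.
    p·4d-int : ∀ {a b c d} → SquareFree q → AlmostIntegral {p} {q} ⟨ a , b , c , d ⟩ → IsInt (P * (d + d + (d + d)))
    p·4d-int {a} {b} {c} {d} q-sf h =
      let 2x∈ℤ , N∈ℤ = trace-norm-√q (subst AlmostIntegral trace (almostIntegral-+ h′ (almostIntegral-conj√p h′)))
      in subst IsInt (four-fold P d) (norm⇒double-int {q} {P * b + P * b} {P * d + P * d} q-sf 2x∈ℤ N∈ℤ)
      where
      √p̂ α : K
      √p̂ = ⟨ 0ℚ , 1ℚ , 0ℚ , 0ℚ ⟩
      α = ⟨ a , b , c , d ⟩
      h′ : AlmostIntegral (√p̂ *ᴷ α)
      h′ = almostIntegral-* (almostIntegral-order (clears (+ 0 , refl) (+ 1 , refl) (+ 0 , refl) (+ 0 , refl))) h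
      trace : √p̂ *ᴷ α +ᴷ conj√p (√p̂ *ᴷ α) ≡ ⟨ P * b + P * b , 0ℚ , P * d + P * d , 0ℚ ⟩
      trace = coords≡
        (solve 6 (λ P Q a b c d → e₁ (tr P Q a b c d) := P :* b :+ P :* b) refl P Q a b c d)
        (solve 6 (λ P Q a b c d → e₂ (tr P Q a b c d) := con 0ℚ) refl P Q a b c d)
        (solve 6 (λ P Q a b c d → e₃ (tr P Q a b c d) := P :* d :+ P :* d) refl P Q a b c d)
        (solve 6 (λ P Q a b c d → e₄ (tr P Q a b c d) := con 0ℚ) refl P Q a b c d)
        where
        tr : ∀ {n} → (P Q a b c d : Polynomial n) → Coords n
        tr P Q a b c d with times P Q ⟪ con 0ℚ , con 1ℚ , con 0ℚ , con 0ℚ ⟫ ⟪ a , b , c , d ⟫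
        ... | ⟪ a , b , c , d ⟫ = plus ⟪ a , b , c , d ⟫ ⟪ a , :- b , c , :- d ⟫

    -- The traces of α itself down to ℚ(√p) and ℚ(√q) both lose d, hence the factor √q: the trace of
    -- √q α down to ℚ(√p) is 2qc + 2qd√p. Passing from 2qd to 4qd is the cost of `norm⇒double-int`.
    q·4d-int : ∀ {a b c d} → SquareFree p → AlmostIntegral {p} {q} ⟨ a , b , c , d ⟩ → IsInt (Q * (d + d + (d + d)))
    q·4d-int {a} {b} {c} {d} p-sf h =
      let 2x∈ℤ , N∈ℤ = trace-norm-√p (subst AlmostIntegral trace (almostIntegral-+ h′ (almostIntegral-conj√q h′)))
      in subst IsInt (four-fold Q d) (norm⇒double-int {p} {Q * c + Q * c} {Q * d + Q * d} p-sf 2x∈ℤ N∈ℤ)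
      where
      √q̂ α : K
      √q̂ = ⟨ 0ℚ , 0ℚ , 1ℚ , 0ℚ ⟩
      α = ⟨ a , b , c , d ⟩
      h′ : AlmostIntegral (√q̂ *ᴷ α)
      h′ = almostIntegral-* (almostIntegral-order (clears (+ 0 , refl) (+ 0 , refl) (+ 1 , refl) (+ 0 , refl))) h
      trace : √q̂ *ᴷ α +ᴷ conj√q (√q̂ *ᴷ α) ≡ ⟨ Q * c + Q * c , Q * d + Q * d , 0ℚ , 0ℚ ⟩
      trace = coords≡
        (solve 6 (λ P Q a b c d → e₁ (tr P Q a b c d) := Q :* c :+ Q :* c) refl P Q a b c d)
        (solve 6 (λ P Q a b c d → e₂ (tr P Q a b c d) := Q :* d :+ Q :* d) refl P Q a b c d)
        (solve 6 (λ P Q a b c d → e₃ (tr P Q a b c d) := con 0ℚ) refl P Q a b c d)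
        (solve 6 (λ P Q a b c d → e₄ (tr P Q a b c d) := con 0ℚ) refl P Q a b c d)
        where
        tr : ∀ {n} → (P Q a b c d : Polynomial n) → Coords n
        tr P Q a b c d with times P Q ⟪ con 0ℚ , con 0ℚ , con 1ℚ , con 0ℚ ⟫ ⟪ a , b , c , d ⟫
        ... | ⟪ a , b , c , d ⟫ = plus ⟪ a , b , c , d ⟫ ⟪ a , b , :- c , :- d ⟫

    d-vanishes : ∀ {r a b c d} .{{_ : ℕ.NonZero p}} → SquareFree p → SquareFree q → r ℕ.* gcd p q ℕ.^ 2 ≡ p ℕ.* q →
                 ι (+ 16) * (P * Q * (d * d)) < ι (+ r) → AlmostIntegral {p} {q} ⟨ a , b , c , d ⟩ → d ≡ 0ℚ
    d-vanishes {r} {d = d} p-sf q-sf rgg≡pq 16pqdd<r h = case (int-square (gcd-int p q (p·4d-int q-sf h) (q·4d-int p-sf h)))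
      where
      G = ι (+ gcd p q)
      4d = d + d + (d + d)

      RGG≡PQ : ι (+ r) * (G * G) ≡ P * Q
      RGG≡PQ = begin
        ι (+ r) * (G * G)                       ≡⟨ cong (ι (+ r) *_) (ℕ→ℚ-* (gcd p q) (gcd p q)) ⟨
        ι (+ r) * ℕ→ℚ (gcd p q ℕ.* gcd p q)     ≡⟨ cong (λ g → ι (+ r) * ℕ→ℚ (gcd p q ℕ.* g)) (ℕ.*-identityʳ (gcd p q)) ⟨
        ι (+ r) * ℕ→ℚ (gcd p q ℕ.^ 2)           ≡⟨ ℕ→ℚ-* r (gcd p q ℕ.^ 2) ⟨
        ℕ→ℚ (r ℕ.* gcd p q ℕ.^ 2)               ≡⟨ cong ℕ→ℚ rgg≡pq ⟩
        ℕ→ℚ (p ℕ.* q)                           ≡⟨ ℕ→ℚ-* p q ⟩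
        P * Q                                   ∎
        where open ≡-Reasoning

      case : G * 4d ≡ 0ℚ ⊎ 1ℚ ≤ G * 4d * (G * 4d) → d ≡ 0ℚ
      case (inj₁ G4d≡0) = begin
        d               ≡⟨ solve 1 (λ d → d := con (½ * ½) :* (d :+ d :+ (d :+ d))) refl d ⟩
        ½ * ½ * 4d      ≡⟨ cong (½ * ½ *_) (int-cancel (gcd p q) G4d≡0) ⟩
        ½ * ½ * 0ℚ      ∎
        where
        open ≡-Reasoning
        instance
          g≢0 : ℕ.NonZero (gcd p q)
          g≢0 = ℕ.≢-nonZero (gcd[m,n]≢0 p q (inj₁ (ℕ.≢-nonZero⁻¹ p)))
      case (inj₂ 1≤) = ⊥-elim (<⇒≱ 16pqdd<r (begin
        ι (+ r)                            ≡⟨ ℚ.*-identityʳ (ι (+ r)) ⟨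
        ι (+ r) * 1ℚ                       ≤⟨ ℚ.*-monoˡ-≤-nonNeg (ι (+ r)) {{ℚ.nonNegative (ℕ→ℚ-nonNeg r)}} 1≤ ⟩
        ι (+ r) * (G * 4d * (G * 4d))      ≡⟨ solve 3 (λ r g d → let x = d :+ d :+ (d :+ d) in
                                                r :* (g :* x :* (g :* x)) := con (ι (+ 16)) :* (r :* (g :* g) :* (d :* d)))
                                                refl (ι (+ r)) G d ⟩
        ι (+ 16) * (ι (+ r) * (G * G) * (d * d)) ≡⟨ cong (λ t → ι (+ 16) * (t * (d * d))) RGG≡PQ ⟩
        ι (+ 16) * (P * Q * (d * d))       ∎))
        where open ℚ.≤-Reasoning

  -- Integrality of the coefficient of √p.

  module _ {p q : ℕ} where
    private
      K = Biquadratic p q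
      P = ι (+ p)
      Q = ι (+ q)

    -- The doubles X = 2x and Y = 2y are integers with X² = pY² + 4n, where n is the norm, and p ≡ 2
    -- (mod 4) makes both even. So the integers of ℚ(√p) are those of ℤ[√p].
    quadratic-int : ∀ {x y} → p ℕ.% 4 ≡ 2 → SquareFree p → AlmostIntegral {p} {q} ⟨ x , y , 0ℚ , 0ℚ ⟩ → IsInt x × IsInt y
    quadratic-int {x} {y} p≡2 p-sf h = half-int (X , 2x≡X , proj₁ evens) , half-int (Y , 2y≡Y , proj₂ evens)
      where
      2x∈ℤ : IsInt (x + x)
      2x∈ℤ = proj₁ (trace-norm-√p h)
      N∈ℤ : IsInt (x * x - P * (y * y))
      N∈ℤ = proj₂ (trace-norm-√p h)
      2y∈ℤ : IsInt (y + y)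
      2y∈ℤ = norm⇒double-int {p} {x} {y} p-sf 2x∈ℤ N∈ℤ
      open Σ 2x∈ℤ renaming (proj₁ to X; proj₂ to 2x≡X)
      open Σ 2y∈ℤ renaming (proj₁ to Y; proj₂ to 2y≡Y)
      open Σ N∈ℤ renaming (proj₁ to n; proj₂ to norm≡n)

      XX≡ : X ℤ.* X ≡ + p ℤ.* (Y ℤ.* Y) ℤ.+ + 4 ℤ.* n
      XX≡ = ι-injective (begin
        ι (X ℤ.* X)                                 ≡⟨ ι-* X X ⟩
        ι X * ι X                                   ≡⟨ cong₂ _*_ 2x≡X 2x≡X ⟨
        (x + x) * (x + x)                           ≡⟨ solve 3 (λ p x y → (x :+ x) :* (x :+ x) :=
                                                        p :* ((y :+ y) :* (y :+ y)) :+ con (ι (+ 4)) :* (x :* x :- p :* (y :* y))) refl P x y ⟩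
        P * ((y + y) * (y + y)) + ι (+ 4) * (x * x - P * (y * y)) ≡⟨ cong₂ (λ s t → P * (s * s) + ι (+ 4) * t) 2y≡Y norm≡n ⟩
        P * (ι Y * ι Y) + ι (+ 4) * ι n             ≡⟨ cong₂ _+_ (trans (cong (P *_) (sym (ι-* Y Y))) (sym (ι-* (+ p) (Y ℤ.* Y)))) (sym (ι-* (+ 4) n)) ⟩
        ι (+ p ℤ.* (Y ℤ.* Y)) + ι (+ 4 ℤ.* n)       ≡⟨ ι-+ (+ p ℤ.* (Y ℤ.* Y)) (+ 4 ℤ.* n) ⟨
        ι (+ p ℤ.* (Y ℤ.* Y) ℤ.+ + 4 ℤ.* n)         ∎)
        where open ≡-Reasoning
      evens : Even X × Even Y
      evens = norm-even (+ (p ℕ./ 4)) X Y n (trans XX≡ (cong (λ t → t ℤ.* (Y ℤ.* Y) ℤ.+ + 4 ℤ.* n) (residue p p≡2)))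

    -- The trace 2a + 2b√p and the norm a² + pb² - qc² + 2ab√p down to ℚ(√p) lie in ℤ[√p]. The
    -- coefficient 2ab gives the parity condition on XY, and the rational part of the norm ties X =
    -- 2a, Y = 2b and Z = 2c together modulo 4. The vanishing of d is essential: (√p + √r)/2 is an
    -- algebraic integer.
    b-int : ∀ {a b c} → p ℕ.% 4 ≡ 2 → q ℕ.% 4 ≡ 3 → SquareFree p → SquareFree q →
            AlmostIntegral {p} {q} ⟨ a , b , c , 0ℚ ⟩ → IsInt b
    b-int {a} {b} {c} p≡2 q≡3 p-sf q-sf h = half-int (Y , 2b≡Y ,
      relative-norm-even (+ (p ℕ./ 4)) (+ (q ℕ./ 4)) X Y Z u w XY≡2u
        (trans (cong (λ t → X ℤ.* X ℤ.+ t ℤ.* (Y ℤ.* Y)) (sym (residue p p≡2)))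
          (trans norm≡ (cong (λ t → t ℤ.* (Z ℤ.* Z) ℤ.+ + 4 ℤ.* w) (residue q q≡3)))))
      where
      α : K
      α = ⟨ a , b , c , 0ℚ ⟩
      trace : α +ᴷ conj√q α ≡ ⟨ a + a , b + b , 0ℚ , 0ℚ ⟩
      trace = coords≡ refl refl (ℚ.+-inverseʳ c) refl
      norm : α *ᴷ conj√q α ≡ ⟨ a * a + P * (b * b) - Q * (c * c) , a * b + a * b , 0ℚ , 0ℚ ⟩
      norm = coords≡
        (solve 5 (λ P Q a b c → e₁ (α·ᾱ P Q a b c) := a :* a :+ P :* (b :* b) :- Q :* (c :* c)) refl P Q a b c)
        (solve 5 (λ P Q a b c → e₂ (α·ᾱ P Q a b c) := a :* b :+ a :* b) refl P Q a b c)
        (solve 5 (λ P Q a b c → e₃ (α·ᾱ P Q a b c) := con 0ℚ) refl P Q a b c)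
        (solve 5 (λ P Q a b c → e₄ (α·ᾱ P Q a b c) := con 0ℚ) refl P Q a b c)
        where
        α·ᾱ : ∀ {n} → (P Q a b c : Polynomial n) → Coords n
        α·ᾱ P Q a b c = times P Q ⟪ a , b , c , con 0ℚ ⟫ ⟪ a , b , :- c , con 0ℚ ⟫

      trace∈ℤ : IsInt (a + a) × IsInt (b + b)
      trace∈ℤ = quadratic-int p≡2 p-sf (subst AlmostIntegral trace (almostIntegral-+ h (almostIntegral-conj√q h)))
      norm∈ℤ : IsInt (a * a + P * (b * b) - Q * (c * c)) × IsInt (a * b + a * b)
      norm∈ℤ = quadratic-int p≡2 p-sf (subst AlmostIntegral norm (almostIntegral-* h (almostIntegral-conj√q h)))
      2c∈ℤ : IsInt (c + c)
      2c∈ℤ = squareFree-int (c + c) q-sf (subst IsInt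
        (solve 5 (λ P Q a b c → (a :+ a) :* (a :+ a) :+ P :* ((b :+ b) :* (b :+ b))
            :- con (ι (+ 4)) :* (a :* a :+ P :* (b :* b) :- Q :* (c :* c)) := Q :* ((c :+ c) :* (c :+ c))) refl P Q a b c)
        (int-- (int-+ (int-* (proj₁ trace∈ℤ) (proj₁ trace∈ℤ)) (int-* (+ p , refl) (int-* (proj₂ trace∈ℤ) (proj₂ trace∈ℤ))))
          (int-* (+ 4 , refl) (proj₁ norm∈ℤ))))
      open Σ (proj₁ trace∈ℤ) renaming (proj₁ to X; proj₂ to 2a≡X)
      open Σ (proj₂ trace∈ℤ) renaming (proj₁ to Y; proj₂ to 2b≡Y)
      open Σ (proj₁ norm∈ℤ) renaming (proj₁ to w; proj₂ to norm≡w)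
      open Σ (proj₂ norm∈ℤ) renaming (proj₁ to u; proj₂ to 2ab≡u)
      open Σ 2c∈ℤ renaming (proj₁ to Z; proj₂ to 2c≡Z)

      open ≡-Reasoning
      XY≡2u : X ℤ.* Y ≡ + 2 ℤ.* u
      XY≡2u = ι-injective (begin
        ι (X ℤ.* Y)                  ≡⟨ ι-* X Y ⟩
        ι X * ι Y                    ≡⟨ cong₂ _*_ 2a≡X 2b≡Y ⟨
        (a + a) * (b + b)            ≡⟨ solve 2 (λ a b → (a :+ a) :* (b :+ b) := con (ι (+ 2)) :* (a :* b :+ a :* b)) refl a b ⟩
        ι (+ 2) * (a * b + a * b)    ≡⟨ cong (ι (+ 2) *_) 2ab≡u ⟩
        ι (+ 2) * ι u                ≡⟨ ι-* (+ 2) u ⟨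
        ι (+ 2 ℤ.* u)                ∎)
      product : ∀ n Y → ι (+ n) * (ι Y * ι Y) ≡ ι (+ n ℤ.* (Y ℤ.* Y))
      product n Y = trans (cong (ι (+ n) *_) (sym (ι-* Y Y))) (sym (ι-* (+ n) (Y ℤ.* Y)))
      norm≡ : X ℤ.* X ℤ.+ + p ℤ.* (Y ℤ.* Y) ≡ + q ℤ.* (Z ℤ.* Z) ℤ.+ + 4 ℤ.* w
      norm≡ = ι-injective (begin
        ι (X ℤ.* X ℤ.+ + p ℤ.* (Y ℤ.* Y))                 ≡⟨ ι-+ (X ℤ.* X) (+ p ℤ.* (Y ℤ.* Y)) ⟩
        ι (X ℤ.* X) + ι (+ p ℤ.* (Y ℤ.* Y))               ≡⟨ cong₂ _+_ (ι-* X X) (sym (product p Y)) ⟩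
        ι X * ι X + P * (ι Y * ι Y)                       ≡⟨ cong₂ (λ x y → x * x + P * (y * y)) 2a≡X 2b≡Y ⟨
        (a + a) * (a + a) + P * ((b + b) * (b + b))       ≡⟨ solve 5 (λ P Q a b c → (a :+ a) :* (a :+ a) :+ P :* ((b :+ b) :* (b :+ b)) :=
                                                              Q :* ((c :+ c) :* (c :+ c)) :+ con (ι (+ 4)) :* (a :* a :+ P :* (b :* b) :- Q :* (c :* c)))
                                                              refl P Q a b c ⟩
        Q * ((c + c) * (c + c)) + ι (+ 4) * (a * a + P * (b * b) - Q * (c * c))
                                                          ≡⟨ cong₂ (λ z w → Q * (z * z) + ι (+ 4) * w) 2c≡Z norm≡w ⟩
        Q * (ι Z * ι Z) + ι (+ 4) * ι w                   ≡⟨ cong₂ _+_ (product q Z) (sym (ι-* (+ 4) w)) ⟩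
        ι (+ q ℤ.* (Z ℤ.* Z)) + ι (+ 4 ℤ.* w)             ≡⟨ ι-+ (+ q ℤ.* (Z ℤ.* Z)) (+ 4 ℤ.* w) ⟨
        ι (+ q ℤ.* (Z ℤ.* Z) ℤ.+ + 4 ℤ.* w)               ∎)

  -- Rational parts and √p-coefficients of sums of squares.

  module _ {p q : ℕ} where
    private
      K = Biquadratic p q
      P = ι (+ p)
      Q = ι (+ q)

    open Biquadratic

    square-coeff₁-nonNeg : (α : K) → 0ℚ ≤ coeff₁ (α *ᴷ α)
    square-coeff₁-nonNeg ⟨ a , b , c , d ⟩ =
      +-nonNeg (+-nonNeg (+-nonNeg (sq-nonNeg a) (*-nonNeg (ℕ→ℚ-nonNeg p) (sq-nonNeg b)))
        (*-nonNeg (ℕ→ℚ-nonNeg q) (sq-nonNeg c)))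
        (*-nonNeg (*-nonNeg (ℕ→ℚ-nonNeg p) (ℕ→ℚ-nonNeg q)) (sq-nonNeg d))

    module _ {r} .{{_ : ℕ.NonZero p}} (p≡2 : p ℕ.% 4 ≡ 2) (q≡3 : q ℕ.% 4 ≡ 3)
             (p-sf : SquareFree p) (q-sf : SquareFree q) (rgg≡pq : r ℕ.* gcd p q ℕ.^ 2 ≡ p ℕ.* q) where

      square-coeff√p-vanishes : ∀ α → 𝒪 p q α → coeff₁ (α *ᴷ α) ≤ P →
                                ι (+ 16) * coeff₁ (α *ᴷ α) < ι (+ r) → coeff√p (α *ᴷ α) ≡ 0ℚ
      square-coeff√p-vanishes ⟨ a , b , c , d ⟩ α∈𝒪 N≤p 16N<r = begin
        a * b + b * a + Q * (c * d + d * c)      ≡⟨ cong (λ d → a * b + b * a + Q * (c * d + d * c)) d≡0 ⟩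
        a * b + b * a + Q * (c * 0ℚ + 0ℚ * c)    ≡⟨ solve 4 (λ a b Q c → a :* b :+ b :* a :+ Q :* (c :* con 0ℚ :+ con 0ℚ :* c) :=
                                                      con (ι (+ 2)) :* (a :* b)) refl a b Q c ⟩
        ι (+ 2) * (a * b)                        ≡⟨ cong (ι (+ 2) *_) (ab≡0 (int-square b∈ℤ)) ⟩
        ι (+ 2) * 0ℚ                             ∎
        where
        open ≡-Reasoning
        N = a * a + P * (b * b) + Q * (c * c) + P * Q * (d * d)

        α-ai : AlmostIntegral {p} {q} ⟨ a , b , c , d ⟩
        α-ai = integral⇒almostIntegral α∈𝒪

        pqdd≤N : ι (+ 16) * (P * Q * (d * d)) ≤ ι (+ 16) * N
        pqdd≤N = ℚ.*-monoˡ-≤-nonNeg (ι (+ 16)) (≤-from-difference {P * Q * (d * d)} {N} (a * a + P * (b * b) + Q * (c * c))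
          (+-nonNeg (+-nonNeg (sq-nonNeg a) (*-nonNeg (ℕ→ℚ-nonNeg p) (sq-nonNeg b))) (*-nonNeg (ℕ→ℚ-nonNeg q) (sq-nonNeg c)))
          (ℚ.+-comm (a * a + P * (b * b) + Q * (c * c)) (P * Q * (d * d))))

        d≡0 : d ≡ 0ℚ
        d≡0 = d-vanishes {r = r} p-sf q-sf rgg≡pq (ℚ.≤-<-trans pqdd≤N 16N<r) α-ai

        b∈ℤ : IsInt b
        b∈ℤ = b-int p≡2 q≡3 p-sf q-sf (subst (λ d → AlmostIntegral {p} {q} ⟨ a , b , c , d ⟩) d≡0 α-ai)

        ab≡0 : b ≡ 0ℚ ⊎ 1ℚ ≤ b * b → a * b ≡ 0ℚ
        ab≡0 (inj₁ b≡0) = trans (cong (a *_) b≡0) (ℚ.*-zeroʳ a)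
        ab≡0 (inj₂ 1≤bb) = trans (cong (_* b) (square≤0⇒≡0 {a} aa≤0)) (ℚ.*-zeroˡ b)
          where
          aa≤0 : a * a ≤ 0ℚ
          -- The difference -a² is split as p(b² - 1), the other two terms of N, and p - N, each
          -- nonnegative.
          aa≤0 = ≤-from-difference (P * (b * b - 1ℚ) + Q * (c * c) + P * Q * (d * d) + (P - N))
            (+-nonNeg (+-nonNeg (+-nonNeg (*-nonNeg (ℕ→ℚ-nonNeg p) (difference-nonNeg 1≤bb))
                (*-nonNeg (ℕ→ℚ-nonNeg q) (sq-nonNeg c)))
              (*-nonNeg (*-nonNeg (ℕ→ℚ-nonNeg p) (ℕ→ℚ-nonNeg q)) (sq-nonNeg d)))
              (difference-nonNeg N≤p))
            (solve 6 (λ P Q a b c d → con 0ℚ := a :* a :+ (P :* (b :* b :- con 1ℚ) :+ Q :* (c :* c) :+ P :* Q :* (d :* d)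
              :+ (P :- (a :* a :+ P :* (b :* b) :+ Q :* (c :* c) :+ P :* Q :* (d :* d))))) refl P Q a b c d)

      sum-of-squares : List K → K
      sum-of-squares αs = foldr _+ᴷ_ 0ᴷ (map (λ α → α *ᴷ α) αs)

      sum-of-squares-coeff₁-nonNeg : ∀ αs → 0ℚ ≤ coeff₁ (sum-of-squares αs)
      sum-of-squares-coeff₁-nonNeg []       = ℚ.≤-refl
      sum-of-squares-coeff₁-nonNeg (α ∷ αs) =
        +-nonNeg (square-coeff₁-nonNeg α) (sum-of-squares-coeff₁-nonNeg αs)

      sum-of-squares-coeff√p-vanishes : ∀ αs → All (𝒪 p q) αs → coeff₁ (sum-of-squares αs) ≤ P →
        ι (+ 16) * coeff₁ (sum-of-squares αs) < ι (+ r) → coeff√p (sum-of-squares αs) ≡ 0ℚ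
      sum-of-squares-coeff√p-vanishes []       []           _   _     = refl
      sum-of-squares-coeff√p-vanishes (α ∷ αs) (α∈𝒪 ∷ αs∈𝒪) S≤p 16S<r = cong₂ _+_
        (square-coeff√p-vanishes α α∈𝒪 (ℚ.≤-trans N≤S S≤p) (ℚ.≤-<-trans (16* N≤S) 16S<r))
        (sum-of-squares-coeff√p-vanishes αs αs∈𝒪 (ℚ.≤-trans S′≤S S≤p) (ℚ.≤-<-trans (16* S′≤S) 16S<r))
        where
        N S′ : ℚ
        N  = coeff₁ (α *ᴷ α)
        S′ = coeff₁ (sum-of-squares αs)
        16* : ∀ {x y} → x ≤ y → ι (+ 16) * x ≤ ι (+ 16) * y
        16* {x} {y} = ℚ.*-monoˡ-≤-nonNeg (ι (+ 16))
        N≤S : N ≤ N + S′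
        N≤S = ≤-from-difference S′ (sum-of-squares-coeff₁-nonNeg αs) refl
        S′≤S : S′ ≤ N + S′
        S′≤S = ≤-from-difference N (square-coeff₁-nonNeg α) (ℚ.+-comm N S′)

  -- From real inequalities to inequalities between integers.

  <-from-difference : ∀ {a b} c → 0ℚ < c → b ≡ a + c → a < b
  <-from-difference {a} c 0<c refl = subst (_< a + c) (ℚ.+-identityʳ a) (ℚ.+-monoʳ-< a 0<c)

  difference-pos : ∀ {a b} → a < b → 0ℚ < b - a
  difference-pos {a} {b} a<b = subst (_< b - a) (ℚ.+-inverseʳ a) (ℚ.+-monoˡ-< (- a) a<b)

  close⇒≤ : ∀ {a b ε} → ∣ a - b ∣ < ε → a ≤ b + ε
  close⇒≤ {a} {b} {ε} a~b = ≤-from-difference (ε - (a - b)) (difference-nonNeg (ℚ.<⇒≤ (ℚ.≤-<-trans (a≤∣a∣ (a - b)) a~b)))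
    (solve 3 (λ a b e → b :+ e := a :+ (e :- (a :- b))) refl a b ε)

  -- One index n beyond M and both Cauchy moduli decides the matter: if xₙ exceeded yₙ + ε, errors
  -- of at most ε/4 in each sequence would keep the tails at least ε/4 apart, contradicting the
  -- negation inside `≤ᴿ`. The free lower bound M lets the mesh be small at the same index.
  ≤ᴿ⇒frequently : ∀ x y → x ≤ᴿ y → ∀ ε → 0ℚ < ε → ∀ M → ∃[ n ] (M ℕ.≤ n × seq x n ≤ seq y n + ε)
  ≤ᴿ⇒frequently x y x≤y ε ε>0 M with cauchy x (ε * ½ * ½) (half-pos (half-pos ε>0)) | cauchy y (ε * ½ * ½) (half-pos (half-pos ε>0))
  ... | N₁ , hx | N₂ , hy with seq x (M ℕ.⊔ (N₁ ℕ.⊔ N₂)) ℚ.≤? seq y (M ℕ.⊔ (N₁ ℕ.⊔ N₂)) + ε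
  ... | yes x≤y+ε = M ℕ.⊔ (N₁ ℕ.⊔ N₂) , ℕ.m≤m⊔n M (N₁ ℕ.⊔ N₂) , x≤y+ε
  ... | no x≰y+ε = ⊥-elim (x≤y (η , half-pos (half-pos ε>0) , n , λ k n≤k → separated k n≤k))
    where
    η = ε * ½ * ½
    n = M ℕ.⊔ (N₁ ℕ.⊔ N₂)
    N₁≤n : N₁ ℕ.≤ n
    N₁≤n = ℕ.≤-trans (ℕ.m≤m⊔n N₁ N₂) (ℕ.m≤n⊔m M (N₁ ℕ.⊔ N₂))
    N₂≤n : N₂ ℕ.≤ n
    N₂≤n = ℕ.≤-trans (ℕ.m≤n⊔m N₁ N₂) (ℕ.m≤n⊔m M (N₁ ℕ.⊔ N₂))
    separated : ∀ k → n ℕ.≤ k → seq y k + η ≤ seq x k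
    separated k n≤k = ≤-from-difference
      ((xₖ + η - xₙ) + (xₙ - (yₙ + ε)) + (yₙ + η - yₖ) + η)
      (+-nonNeg (+-nonNeg (+-nonNeg
        (difference-nonNeg (close⇒≤ {xₙ} {xₖ} (hx n k N₁≤n (ℕ.≤-trans N₁≤n n≤k))))
        (difference-nonNeg (ℚ.<⇒≤ (ℚ.≰⇒> x≰y+ε))))
        (difference-nonNeg (close⇒≤ {yₖ} {yₙ} (hy k n (ℕ.≤-trans N₂≤n n≤k) N₂≤n))))
        (ℚ.<⇒≤ (half-pos (half-pos ε>0))))
      (solve 5 (λ xk yk xn yn e → let h = e :* con ½ :* con ½ in
        xk := yk :+ h :+ ((xk :+ h :- xn) :+ (xn :- (yn :+ e)) :+ (yn :+ h :- yk) :+ h)) refl xₖ yₖ xₙ yₙ ε)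
      where
      xₖ = seq x k
      yₖ = seq y k
      xₙ = seq x n
      yₙ = seq y n

  √-nonNeg : ∀ x k → 0ℚ ≤ seq (√ x) k
  √-nonNeg x k = SqrtApprox.s≥0 (sqrtApprox (seq x k) k)

  √-lower : ∀ x k → seq (√ x) k ≡ 0ℚ ⊎ seq (√ x) k * seq (√ x) k ≤ seq x k
  √-lower x k = SqrtApprox.lower (sqrtApprox (seq x k) k)

  √-upper : ∀ x k → seq x k < (seq (√ x) k + mesh k) * (seq (√ x) k + mesh k)
  √-upper x k = SqrtApprox.upper (sqrtApprox (seq x k) k)

  -- The proofs below see a square root only through these bounds, because
  -- the approximations computed by √ must not be unfolded.
  record IsSqrt (S : ℝ) (n : ℕ) : Set where
    field
      nonNeg : ∀ k → 0ℚ ≤ seq S k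
      lower  : ∀ k → seq S k * seq S k ≤ ℕ→ℚ n
      upper  : ∀ k → ℕ→ℚ n < (seq S k + mesh k) * (seq S k + mesh k)

  √-isSqrt : ∀ n → IsSqrt (√ (ℕ→ℝ n)) n
  √-isSqrt n = record
    { nonNeg = √-nonNeg (ℕ→ℝ n)
    ; lower  = λ k → square≤ (√-lower (ℕ→ℝ n) k)
    ; upper  = √-upper (ℕ→ℝ n)
    }
    where
    square≤ : ∀ {s} → s ≡ 0ℚ ⊎ s * s ≤ ℕ→ℚ n → s * s ≤ ℕ→ℚ n
    square≤ (inj₁ s≡0)  = subst (_≤ ℕ→ℚ n) (sym (trans (cong (λ t → t * t) s≡0) (ℚ.*-zeroˡ 0ℚ))) (ℕ→ℚ-nonNeg n)
    square≤ (inj₂ s²≤n) = s²≤n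

  -- With s ≤ c + ε and mesh at most ε, the upper bound on n gives n < (c + 2ε)² ≤ c² + (4c + 4)ε,
  -- which is c² + 1 for a suitable ε. One good index is enough, so the hypothesis asks for no more.
  -- A negative C would force s ≤ -1 + ½ < 0.
  sqrt-≤-integer : ∀ {S n} C → IsSqrt S n → (∀ ε → 0ℚ < ε → ∃[ k ] (seq S k ≤ ι C + ε × mesh k ≤ ε)) →
                   ∃[ c ] (C ≡ + c × n ℕ.≤ c ℕ.* c)
  sqrt-≤-integer -[1+ c ] S=√n bound = ⊥-elim (<⇒≱ C+½<0 (ℚ.≤-trans (IsSqrt.nonNeg S=√n k) (proj₁ (proj₂ (bound ½ (ℚ.positive⁻¹ ½))))))
    where
    k = proj₁ (bound ½ (ℚ.positive⁻¹ ½))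
    C+½<0 : ι -[1+ c ] + ½ < 0ℚ
    C+½<0 = ℚ.≤-<-trans (ℚ.+-monoˡ-≤ ½ (ι-mono-≤ { -[1+ c ]} { -[1+ 0 ]} (ℤ.-≤- ℕ.z≤n))) (ℚ.negative⁻¹ (- 1ℚ + ½))
  sqrt-≤-integer {S} {n} (+ c) S=√n bound = c , refl , ℕ.≮⇒≥ λ cc<n → <⇒≱ n<cc+1 (ι-mono-≤ (ℤ.+≤+ cc<n))
    where
    -- This is 1/(4c + 4), as `mesh n` is 1/(n + 1).
    ε = mesh (4 ℕ.* c ℕ.+ 3)
    k = proj₁ (bound ε (mesh-pos (4 ℕ.* c ℕ.+ 3)))
    s≤c+ε = proj₁ (proj₂ (bound ε (mesh-pos (4 ℕ.* c ℕ.+ 3))))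
    δ≤ε = proj₂ (proj₂ (bound ε (mesh-pos (4 ℕ.* c ℕ.+ 3))))
    s = seq S k
    open IsSqrt S=√n
    c′ = ℕ→ℚ c

    0≤ε : 0ℚ ≤ ε
    0≤ε = ℚ.<⇒≤ (mesh-pos (4 ℕ.* c ℕ.+ 3))

    [4c+4]ε≡1 : (ι (+ 4) * c′ + ι (+ 4)) * ε ≡ 1ℚ
    [4c+4]ε≡1 = trans (cong (_* ε) (begin
      ι (+ 4) * c′ + ι (+ 4)             ≡⟨ cong (_+ ι (+ 4)) (ℕ→ℚ-* 4 c) ⟨
      ℕ→ℚ (4 ℕ.* c) + ι (+ 4)            ≡⟨ ι-+ (+ (4 ℕ.* c)) (+ 4) ⟨
      ℕ→ℚ (4 ℕ.* c ℕ.+ 4)                ≡⟨ cong ℕ→ℚ (ℕ.+-suc (4 ℕ.* c) 3) ⟩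
      ℕ→ℚ (suc (4 ℕ.* c ℕ.+ 3))          ∎)) (suc*mesh (4 ℕ.* c ℕ.+ 3))
      where open ≡-Reasoning

    ε≤1 : ε ≤ 1ℚ
    ε≤1 = ≤-from-difference (ι (+ 4) * c′ * ε + ι (+ 3) * ε)
      (+-nonNeg (*-nonNeg (*-nonNeg (ℕ→ℚ-nonNeg 4) (ℕ→ℚ-nonNeg c)) 0≤ε) (*-nonNeg (ℕ→ℚ-nonNeg 3) 0≤ε))
      (trans (sym [4c+4]ε≡1) (solve 2 (λ c e → (con (ι (+ 4)) :* c :+ con (ι (+ 4))) :* e :=
        e :+ (con (ι (+ 4)) :* c :* e :+ con (ι (+ 3)) :* e)) refl c′ ε))

    n<cc+1 : ℕ→ℚ n < ℕ→ℚ (suc (c ℕ.* c))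
    n<cc+1 = begin-strict
      ℕ→ℚ n                               <⟨ upper k ⟩
      (s + mesh k) * (s + mesh k)         ≤⟨ sq-mono (ℚ.+-mono-≤ (nonNeg k) (ℚ.<⇒≤ (mesh-pos k))) (ℚ.+-mono-≤ s≤c+ε δ≤ε) ⟩
      (c′ + ε + ε) * (c′ + ε + ε)         ≤⟨ ≤-from-difference (ι (+ 4) * ε * (1ℚ - ε))
                                               (*-nonNeg (*-nonNeg (ℕ→ℚ-nonNeg 4) 0≤ε) (difference-nonNeg ε≤1))
                                               (solve 2 (λ c e → c :* c :+ (con (ι (+ 4)) :* c :+ con (ι (+ 4))) :* e :=
                                                 (c :+ e :+ e) :* (c :+ e :+ e) :+ con (ι (+ 4)) :* e :* (con 1ℚ :- e)) refl c′ ε) ⟩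
      c′ * c′ + (ι (+ 4) * c′ + ι (+ 4)) * ε ≡⟨ cong₂ _+_ (sym (ℕ→ℚ-* c c)) [4c+4]ε≡1 ⟩
      ℕ→ℚ (c ℕ.* c) + 1ℚ                  ≡⟨ ℕ→ℚ-suc (c ℕ.* c) ⟨
      ℕ→ℚ (suc (c ℕ.* c))                 ∎
      where open ℚ.≤-Reasoning

  sqrt≤ᴿ⇒square : ∀ {S n} C → IsSqrt S n → S ≤ᴿ ℤ→ℝ C → ∃[ c ] (C ≡ + c × n ℕ.≤ c ℕ.* c)
  sqrt≤ᴿ⇒square {S} C S=√n S≤C = sqrt-≤-integer C S=√n λ ε ε>0 →
    let M , small = mesh-small ε ε>0
        k , M≤k , s≤C+ε = ≤ᴿ⇒frequently S (ℤ→ℝ C) S≤C ε ε>0 M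
    in k , s≤C+ε , small k M≤k

  -- Used with C - S = N₁: the presupposition N₁ ≥ 0 is the source of p ≤ (N₁ + √p)².
  0≤ᴿ-sqrt⇒square : ∀ {S n} C → IsSqrt S n → 0ℝ ≤ᴿ ℤ→ℝ C -ᴿ S → ∃[ c ] (C ≡ + c × n ℕ.≤ c ℕ.* c)
  0≤ᴿ-sqrt⇒square {S} C S=√n 0≤C-S = sqrt-≤-integer C S=√n λ ε ε>0 →
    let M , small = mesh-small ε ε>0
        k , M≤k , 0≤C-s+ε = ≤ᴿ⇒frequently 0ℝ (ℤ→ℝ C -ᴿ S) 0≤C-S ε ε>0 M
    in k , move (seq S k) ε 0≤C-s+ε , small k M≤k
    where
    move : ∀ s ε → 0ℚ ≤ ι C + - s + ε → s ≤ ι C + ε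
    move s ε 0≤ = ≤-from-difference (ι C + - s + ε) 0≤
      (solve 3 (λ C s e → C :+ e := s :+ (C :+ :- s :+ e)) refl (ι C) s ε)

  -- AM–GM in the form 2ms ≤ m² + s² ≤ m² + p absorbs the term 2m√p of 2m N₁.
  bound⇒m*M≤p : ∀ {s t δ} m p M → 1 ℕ.≤ m → s * s ≤ ℕ→ℚ p → 0ℚ ≤ t → 0ℚ ≤ δ → δ ≤ ½ →
    ℕ→ℚ (2 ℕ.* m) * (ι M + - s) < (t + δ) * (t + δ) →
    (ℕ→ℚ m + t) * (ℕ→ℚ m + t) ≤ ℕ→ℚ p + ½ → + m ℤ.* M ℤ.≤ + p
  bound⇒m*M≤p {s} {t} {δ} m p M 1≤m s²≤p 0≤t 0≤δ δ≤½ 2m[M-s]<[t+δ]² [m+t]²≤p+½ =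
    ℤ.≮⇒≥ λ p<mM → <⇒≱ mM<p+1 (ι-mono-≤ (ℤ.i<j⇒suc[i]≤j p<mM))
    where
    m′ = ℕ→ℚ m
    M′ = ι M
    p′ = ℕ→ℚ p

    bound : ι (+ 2) * m′ * (M′ + - s) < (t + δ) * (t + δ)
    bound = subst (λ x → x * (M′ + - s) < (t + δ) * (t + δ)) (ℕ→ℚ-* 2 m) 2m[M-s]<[t+δ]²

    1≤m′ : 1ℚ ≤ m′
    1≤m′ = ι-mono-≤ {+ 1} {+ m} (ℤ.+≤+ 1≤m)

    δ≤m : δ ≤ m′
    δ≤m = ℚ.≤-trans δ≤½ (ℚ.≤-trans (ℚ.<⇒≤ (ℚ.*<* (ℤ.+<+ (ℕ.s≤s (ℕ.s≤s ℕ.z≤n))))) 1≤m′)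

    slack : ℚ
    slack = (t + δ) * (t + δ) - ι (+ 2) * m′ * (M′ + - s)

    -- Chosen so that `slack + rest` equals 2(p + 1 - mM). The tolerance ½ and the bound δ ≤ ½ keep
    -- the errors in 2mM ≤ 2p below 2, and the cross term 2mt of (m + t)² absorbs 2tδ however large
    -- t is, because δ ≤ m.
    rest : ℚ
    rest = (p′ + ½ - (m′ + t) * (m′ + t)) + (p′ - s * s) + (m′ - s) * (m′ - s)
           + ((½ * ½ - δ * δ) + (½ * ½ + (1ℚ + ι (+ 2) * (t * (m′ - δ)))))

    0≤rest : 0ℚ ≤ rest
    0≤rest = +-nonNeg
      (+-nonNeg (+-nonNeg (difference-nonNeg [m+t]²≤p+½) (difference-nonNeg s²≤p)) (sq-nonNeg (m′ - s)))
      (+-nonNeg (difference-nonNeg (sq-mono 0≤δ δ≤½))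
        (+-nonNeg (ℚ.nonNegative⁻¹ (½ * ½)) (+-nonNeg (ℚ.nonNegative⁻¹ 1ℚ)
          (*-nonNeg (ℕ→ℚ-nonNeg 2) (*-nonNeg 0≤t (difference-nonNeg δ≤m))))))

    mM<p+1 : ι (+ m ℤ.* M) < ι (ℤ.suc (+ p))
    mM<p+1 = <-from-difference (½ * (slack + rest))
      (*-pos (ℚ.positive⁻¹ ½) (ℚ.+-mono-<-≤ (difference-pos bound) 0≤rest))
      (begin
        ι (ℤ.suc (+ p))                  ≡⟨ ι-+ (+ 1) (+ p) ⟩
        1ℚ + p′                          ≡⟨ solve 6 (λ m M p s t d →
          con 1ℚ :+ p := m :* M :+ con ½ :* (((t :+ d) :* (t :+ d) :- con (ι (+ 2)) :* m :* (M :+ :- s))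
            :+ ((p :+ con ½ :- (m :+ t) :* (m :+ t)) :+ (p :- s :* s) :+ (m :- s) :* (m :- s)
              :+ ((con (½ * ½) :- d :* d) :+ (con (½ * ½) :+ (con 1ℚ :+ con (ι (+ 2)) :* (t :* (m :- d))))))))
          refl m′ M′ p′ s t δ ⟩
        m′ * M′ + ½ * (slack + rest)     ≡⟨ cong (_+ ½ * (slack + rest)) (ι-* (+ m) M) ⟨
        ι (+ m ℤ.* M) + ½ * (slack + rest) ∎)
      where open ≡-Reasoning

  -- The bounds on S and T hold at every index, so one index with mesh at most ½, at which the
  -- squared bound holds up to ½, settles the inequality between integers. Here T is to be √(2mN₁),
  -- where N₁ = M - √p.
  boundᴿ⇒m*M≤p : ∀ {S} m p M → 1 ℕ.≤ m → IsSqrt S p → ∀ {T} → (∀ k → 0ℚ ≤ seq T k) →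
    (∀ k → ℕ→ℚ (2 ℕ.* m) * (ι M + - seq S k) < (seq T k + mesh k) * (seq T k + mesh k)) →
    (ℕ→ℝ m +ᴿ T) *ᴿ (ℕ→ℝ m +ᴿ T) ≤ᴿ ℕ→ℝ p → + m ℤ.* M ℤ.≤ + p
  boundᴿ⇒m*M≤p {S} m p M 1≤m S=√p {T} 0≤T upper b²≤p =
    conclude (proj₂ half-mesh) (≤ᴿ⇒frequently (b *ᴿ b) (ℕ→ℝ p) b²≤p ½ (ℚ.positive⁻¹ ½) (proj₁ half-mesh))
    where
    b = ℕ→ℝ m +ᴿ T
    half-mesh : ∃[ N ] (∀ n → N ℕ.≤ n → mesh n ≤ ½)
    half-mesh = mesh-small ½ (ℚ.positive⁻¹ ½)
    conclude : ∀ {N} → (∀ n → N ℕ.≤ n → mesh n ≤ ½) →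
               ∃[ n ] (N ℕ.≤ n × seq (b *ᴿ b) n ≤ ℕ→ℚ p + ½) → + m ℤ.* M ℤ.≤ + p
    conclude small (k , N≤k , b²≤p+½) = bound⇒m*M≤p {seq S k} {seq T k} m p M 1≤m
      (IsSqrt.lower S=√p k) (0≤T k) (ℚ.<⇒≤ (mesh-pos k)) (small k N≤k) (upper k) b²≤p+½

  -- The totally positive algebraic integer A + √p.

  -- Let ε = 1/(2A + 1), so that 1 - 2Aε = ε. An approximation s > A - ε would give p ≥ s² ≥ (A -
  -- ε)² > A² - 2Aε ≥ p + 1 - 2Aε > p. The gap is independent of k, as `<ᴿ` demands a uniform one.
  sqrt-gap-below : ∀ {S p} A → p ℕ.< A ℕ.* A → IsSqrt S p → ∀ k → mesh (2 ℕ.* A) ≤ ℕ→ℚ A - seq S k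
  sqrt-gap-below {S} {p} A p<AA S=√p k = ε≤A-s
    where
    ε = mesh (2 ℕ.* A)
    A′ = ℕ→ℚ A
    0<ε : 0ℚ < ε
    0<ε = mesh-pos (2 ℕ.* A)

    1≤A : ∀ A → p ℕ.< A ℕ.* A → 1 ℕ.≤ A
    1≤A (suc _) _ = ℕ.s≤s ℕ.z≤n

    [2A+1]ε≡1 : (1ℚ + ι (+ 2) * A′) * ε ≡ 1ℚ
    [2A+1]ε≡1 = trans (cong (_* ε) (sym (trans (ι-+ (+ 1) (+ (2 ℕ.* A))) (cong (λ t → 1ℚ + t) (ℕ→ℚ-* 2 A))))) (suc*mesh (2 ℕ.* A))

    ε≤A : ε ≤ A′
    ε≤A = ℚ.≤-trans (≤-from-difference (ι (+ 2) * A′ * ε) (*-nonNeg (*-nonNeg (ℕ→ℚ-nonNeg 2) (ℕ→ℚ-nonNeg A)) (ℚ.<⇒≤ 0<ε))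
        (trans (sym [2A+1]ε≡1) (solve 2 (λ A e → (con 1ℚ :+ con (ι (+ 2)) :* A) :* e := e :+ con (ι (+ 2)) :* A :* e) refl A′ ε)))
      (ι-mono-≤ {+ 1} {+ A} (ℤ.+≤+ (1≤A A p<AA)))

    p+1≤AA : ℕ→ℚ p + 1ℚ ≤ A′ * A′
    p+1≤AA = subst (_≤ A′ * A′) (ℕ→ℚ-suc p) (subst (ℕ→ℚ (suc p) ≤_) (ℕ→ℚ-* A A) (ι-mono-≤ (ℤ.+≤+ p<AA)))

    ε≤A-s : ε ≤ A′ - seq S k
    ε≤A-s = ℚ.≮⇒≥ λ A-s<ε → <⇒≱ p<[A-ε]² (ℚ.≤-trans (sq-mono (difference-nonNeg ε≤A) (A-ε≤s A-s<ε)) (IsSqrt.lower S=√p k))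
      where
      s = seq S k
      A-ε≤s : A′ - s < ε → A′ - ε ≤ s
      A-ε≤s A-s<ε = ≤-from-difference (ε - (A′ - s)) (difference-nonNeg (ℚ.<⇒≤ A-s<ε))
        (solve 3 (λ A s e → s := A :- e :+ (e :- (A :- s))) refl A′ s ε)
      p<[A-ε]² : ℕ→ℚ p < (A′ - ε) * (A′ - ε)
      p<[A-ε]² = <-from-difference (A′ * A′ - (ℕ→ℚ p + 1ℚ) + ε + ε * ε)
        (ℚ.+-mono-<-≤ (ℚ.+-mono-≤-< (difference-nonNeg p+1≤AA) 0<ε) (sq-nonNeg ε))
        (begin
          (A′ - ε) * (A′ - ε)
            ≡⟨ solve 3 (λ p A e → (A :- e) :* (A :- e) := p :+ (A :* A :- (p :+ (con 1ℚ :+ con (ι (+ 2)) :* A) :* e) :+ e :+ e :* e))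
                 refl (ℕ→ℚ p) A′ ε ⟩
          ℕ→ℚ p + (A′ * A′ - (ℕ→ℚ p + (1ℚ + ι (+ 2) * A′) * ε) + ε + ε * ε)
            ≡⟨ cong (λ o → ℕ→ℚ p + (A′ * A′ - (ℕ→ℚ p + o) + ε + ε * ε)) [2A+1]ε≡1 ⟩
          ℕ→ℚ p + (A′ * A′ - (ℕ→ℚ p + 1ℚ) + ε + ε * ε) ∎)
        where open ≡-Reasoning

  eventually-positive : ∀ A U V → (∀ k → mesh (2 ℕ.* A) ≤ ℕ→ℚ A + seq U k) →
    0ℝ <ᴿ ℚ→ℝ (ℕ→ℚ A) +ᴿ ℚ→ℝ 1ℚ *ᴿ U +ᴿ ℚ→ℝ 0ℚ *ᴿ V +ᴿ ℚ→ℝ 0ℚ *ᴿ (U *ᴿ V)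
  eventually-positive A U V h = ε , mesh-pos (2 ℕ.* A) , 0 , λ k _ → begin
    0ℚ + ε                   ≡⟨ ℚ.+-identityˡ ε ⟩
    ε                        ≤⟨ h k ⟩
    ℕ→ℚ A + seq U k          ≡⟨ value (ℕ→ℚ A) (seq U k) (seq V k) ⟩
    ℕ→ℚ A + 1ℚ * seq U k + 0ℚ * seq V k + 0ℚ * (seq U k * seq V k) ∎
    where
    open ℚ.≤-Reasoning
    ε = mesh (2 ℕ.* A)
    value : ∀ A u v → A + u ≡ A + 1ℚ * u + 0ℚ * v + 0ℚ * (u * v)
    value = solve 3 (λ A u v → A :+ u := A :+ con 1ℚ :* u :+ con 0ℚ :* v :+ con 0ℚ :* (u :* v)) refl

  A+√p : ∀ {p q} → ℕ → Biquadratic p q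
  A+√p A = ⟨ ℕ→ℚ A , 1ℚ , 0ℚ , 0ℚ ⟩

  A+√p-totallyPositive : ∀ {p q} A → p ℕ.< A ℕ.* A → TotallyPositive {p} {q} (A+√p A)
  A+√p-totallyPositive {p} {q} A p<AA σ τ =
    eventually-positive A (σ ◃ᴿ (√ ℕ→ℝ p)) (τ ◃ᴿ (√ ℕ→ℝ q)) (signed σ)
    where
    gap : ∀ k → mesh (2 ℕ.* A) ≤ ℕ→ℚ A - seq (√ ℕ→ℝ p) k
    gap = sqrt-gap-below A p<AA (√-isSqrt p)
    signed : ∀ σ k → mesh (2 ℕ.* A) ≤ ℕ→ℚ A + seq (σ ◃ᴿ (√ ℕ→ℝ p)) k
    signed Sign.- = gap
    signed Sign.+ k = ℚ.≤-trans (gap k) (ℚ.+-monoʳ-≤ (ℕ→ℚ A) (-s≤s (√-nonNeg (ℕ→ℝ p) k)))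
      where
      -s≤s : ∀ {s} → 0ℚ ≤ s → - s ≤ s
      -s≤s 0≤s = ℚ.≤-trans (ℚ.neg-antimono-≤ 0≤s) 0≤s

  A+√p-integral : ∀ {p q} A → 𝒪 p q (A+√p A)
  A+√p-integral {p} {q} A = c₀ ∷ c₁ ∷ [] , (begin
    ℤ→ᴷ c₀ +ᴷ α *ᴷ (ℤ→ᴷ c₁ +ᴷ α *ᴷ 1ᴷ)  ≡⟨ cong (λ x → ℤ→ᴷ c₀ +ᴷ α *ᴷ (ℤ→ᴷ c₁ +ᴷ x)) (trans (*ᴷ-comm α 1ᴷ) (*ᴷ-identityˡ α)) ⟩
    ℤ→ᴷ c₀ +ᴷ α *ᴷ (ℤ→ᴷ c₁ +ᴷ α)        ≡⟨ cong₂ (λ x y → ⟨ x , 0ℚ , 0ℚ , 0ℚ ⟩ +ᴷ α *ᴷ (⟨ y , 0ℚ , 0ℚ , 0ℚ ⟩ +ᴷ α)) ιc₀ ιc₁ ⟩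
    ⟨ A′ * A′ - P , 0ℚ , 0ℚ , 0ℚ ⟩ +ᴷ α *ᴷ (⟨ - (ι (+ 2) * A′) , 0ℚ , 0ℚ , 0ℚ ⟩ +ᴷ α)
                                         ≡⟨ coords≡
      (solve 3 (λ P Q A → e₁ (value P Q A) := con 0ℚ) refl P Q A′)
      (solve 3 (λ P Q A → e₂ (value P Q A) := con 0ℚ) refl P Q A′)
      (solve 3 (λ P Q A → e₃ (value P Q A) := con 0ℚ) refl P Q A′)
      (solve 3 (λ P Q A → e₄ (value P Q A) := con 0ℚ) refl P Q A′) ⟩
    0ᴷ ∎)
    where
    open ≡-Reasoning
    P = ℕ→ℚ p
    Q = ℕ→ℚ q
    A′ = ℕ→ℚ A
    α : Biquadratic p q
    α = A+√p A
    -- The coefficients of (X - A)² - p below the leading one.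
    c₀ c₁ : ℤ
    c₀ = + A ℤ.* + A ℤ.- + p
    c₁ = ℤ.- (+ 2 ℤ.* + A)
    ιc₀ : ι c₀ ≡ A′ * A′ - P
    ιc₀ = trans (ι-- (+ A ℤ.* + A) (+ p)) (cong (_- P) (ι-* (+ A) (+ A)))
    ιc₁ : ι c₁ ≡ - (ι (+ 2) * A′)
    ιc₁ = trans (ι-neg (+ 2 ℤ.* + A)) (cong -_ (ι-* (+ 2) (+ A)))
    value : ∀ {n} → (P Q A : Polynomial n) → Coords n
    value P Q A = plus ⟪ A :* A :- P , con 0ℚ , con 0ℚ , con 0ℚ ⟫
      (times P Q ⟪ A , con 1ℚ , con 0ℚ , con 0ℚ ⟫
        (plus ⟪ :- (con (ι (+ 2)) :* A) , con 0ℚ , con 0ℚ , con 0ℚ ⟫ ⟪ A , con 1ℚ , con 0ℚ , con 0ℚ ⟫))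

  A+√p-multiple : ∀ {p q} m A → ℤ→ᴷ {p} {q} (+ m) *ᴷ A+√p A ≡ ⟨ ℕ→ℚ (m ℕ.* A) , ℕ→ℚ m , 0ℚ , 0ℚ ⟩
  A+√p-multiple {p} {q} m A = trans
    (coords≡
      (solve 4 (λ P Q m A → e₁ (value P Q m A) := m :* A) refl P Q m′ A′)
      (solve 4 (λ P Q m A → e₂ (value P Q m A) := m) refl P Q m′ A′)
      (solve 4 (λ P Q m A → e₃ (value P Q m A) := con 0ℚ) refl P Q m′ A′)
      (solve 4 (λ P Q m A → e₄ (value P Q m A) := con 0ℚ) refl P Q m′ A′))
    (cong (λ x → ⟨ x , m′ , 0ℚ , 0ℚ ⟩) (sym (ℕ→ℚ-* m A)))
    where
    P = ℕ→ℚ p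
    Q = ℕ→ℚ q
    m′ = ℕ→ℚ m
    A′ = ℕ→ℚ A
    value : ∀ {n} → (P Q m A : Polynomial n) → Coords n
    value P Q m A = times P Q ⟪ m , con 0ℚ , con 0ℚ , con 0ℚ ⟫ ⟪ A , con 1ℚ , con 0ℚ , con 0ℚ ⟫

  -- The contradiction and the choice of A.

  not-all-sums-of-squares : ∀ {p q r m} A → 1 ℕ.≤ p → p ℕ.% 4 ≡ 2 → q ℕ.% 4 ≡ 3 → SquareFree p → SquareFree q →
    r ℕ.* gcd p q ℕ.^ 2 ≡ p ℕ.* q → 1 ℕ.≤ m →
    p ℕ.≤ A ℕ.* A → m ℕ.* A ℕ.≤ p → 16 ℕ.* (m ℕ.* A) ℕ.< r →
    ¬ ((_·𝒪⁺ p q m) ⊆ SumOfSquares p q)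
  not-all-sums-of-squares {p} {q} {r} {m} A 1≤p p≡2 q≡3 p-sf q-sf rgg≡pq 1≤m p≤AA mA≤p 16mA<r all-sums =
    contradict (all-sums (A+√p A , (A+√p-integral {p} {q} A , A+√p-totallyPositive {p} {q} A p<AA) , sym (A+√p-multiple {p} {q} m A)))
    where
    instance
      p≢0 : ℕ.NonZero p
      p≢0 = ℕ.>-nonZero 1≤p

    p<AA : p ℕ.< A ℕ.* A
    p<AA = ℕ.≤∧≢⇒< p≤AA λ p≡AA → square≢2mod4 (+ (p ℕ./ 4)) (+ A)
      (trans (sym (ℤ.pos-* A A)) (trans (cong +_ (sym p≡AA)) (residue p p≡2)))

    β : Biquadratic p q
    β = ⟨ ℕ→ℚ (m ℕ.* A) , ℕ→ℚ m , 0ℚ , 0ℚ ⟩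

    16mA<ιr : ι (+ 16) * ℕ→ℚ (m ℕ.* A) < ι (+ r)
    16mA<ιr = subst (_< ι (+ r)) (ℕ→ℚ-* 16 (m ℕ.* A)) (ι-mono-< (ℤ.+<+ 16mA<r))

    contradict : ¬ SumOfSquares p q β
    contradict (αs , αs∈𝒪 , β≡Σ) = ℕ.<⇒≢ 1≤m (sym (ℤ.+-injective (ι-injective {+ m} {+ 0} (trans
      (cong coeff√p β≡Σ)
      (sum-of-squares-coeff√p-vanishes {r = r} p≡2 q≡3 p-sf q-sf rgg≡pq αs αs∈𝒪
        (subst (_≤ ℕ→ℚ p) (cong coeff₁ β≡Σ) (ι-mono-≤ (ℤ.+≤+ mA≤p)))
        (subst (λ x → ι (+ 16) * x < ι (+ r)) (cong coeff₁ β≡Σ) 16mA<ιr))))))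
      where open Biquadratic

  -- Here c is ⌈√r⌉ and k is N₁ + √p. As κ ≥ 1, the bound with 16κ implies the one with 16, the
  -- factor that matches the square of 4 in 4gd.
  minimum-admissible : ∀ {p q r m κ} c k → 1 ℕ.≤ p → p ℕ.% 4 ≡ 2 → q ℕ.% 4 ≡ 3 → SquareFree p → SquareFree q →
    r ℕ.* gcd p q ℕ.^ 2 ≡ p ℕ.* q → 1 ℕ.≤ m → 1 ℕ.≤ κ →
    p ℕ.≤ c ℕ.* c → p ℕ.≤ k ℕ.* k → m ℕ.* (16 ℕ.* κ ℕ.* c) ℕ.< r → m ℕ.* k ℕ.≤ p →
    ¬ ((_·𝒪⁺ p q m) ⊆ SumOfSquares p q)
  minimum-admissible {p} {q} {r} {m} {κ} c k 1≤p p≡2 q≡3 p-sf q-sf rgg≡pq 1≤m 1≤κ p≤cc p≤kk 16mκc<r mk≤p =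
    not-all-sums-of-squares A 1≤p p≡2 q≡3 p-sf q-sf rgg≡pq 1≤m p≤AA
      (ℕ.≤-trans (ℕ.*-monoʳ-≤ m (ℕ.m⊓n≤n c k)) mk≤p) 16mA<r
    where
    A = c ℕ.⊓ k
    p≤AA : p ℕ.≤ A ℕ.* A
    p≤AA with ℕ.⊓-sel c k
    ... | inj₁ A≡c = subst (λ a → p ℕ.≤ a ℕ.* a) (sym A≡c) p≤cc
    ... | inj₂ A≡k = subst (λ a → p ℕ.≤ a ℕ.* a) (sym A≡k) p≤kk
    16mA<r : 16 ℕ.* (m ℕ.* A) ℕ.< r
    16mA<r = begin-strict
      16 ℕ.* (m ℕ.* A)         ≤⟨ ℕ.*-monoʳ-≤ 16 (ℕ.*-monoʳ-≤ m (ℕ.m⊓n≤m c k)) ⟩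
      16 ℕ.* (m ℕ.* c)         ≡⟨ ℕ.*-assoc 16 m c ⟨
      16 ℕ.* m ℕ.* c           ≡⟨ cong (ℕ._* c) (ℕ.*-comm 16 m) ⟩
      m ℕ.* 16 ℕ.* c           ≡⟨ ℕ.*-assoc m 16 c ⟩
      m ℕ.* (16 ℕ.* c)         ≤⟨ ℕ.*-monoʳ-≤ m (ℕ.*-monoˡ-≤ c (ℕ.*-monoʳ-≤ 16 1≤κ)) ⟩
      m ℕ.* (16 ℕ.* κ ℕ.* c)   <⟨ 16mκc<r ⟩
      r                        ∎
      where open ℕ.≤-Reasoning

open import Data.Nat.Base using (_≤_; _<_; _*_; _^_; _%_)

theorem2 :
    (p q r m κ : ℕ) →
    2 ≤ p → 2 ≤ q →
    SquareFree p → SquareFree q →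
    p % 4 ≡ 2 → q % 4 ≡ 3 →
    r * gcd p q ^ 2 ≡ p * q →
    p < q → q < r →
    1 ≤ m → 1 ≤ κ →
    let √p = √ (ℕ→ℝ p)
        √q = √ (ℕ→ℝ q)
        √r = √ (ℕ→ℝ r)
    in
    (⌈√r⌉ : ℤ) → IsCeiling √r ⌈√r⌉ →
    + m ℤ.* (+ 16 ℤ.* + κ ℤ.* ⌈√r⌉) ℤ.< + r →
    (⌈2√q-√p⌉ : ℤ) → IsCeiling (ℕ→ℝ 2 *ᴿ √q -ᴿ √p) ⌈2√q-√p⌉ →
    (⌈√r-√p⌉ : ℤ) → IsCeiling (√r -ᴿ √p) ⌈√r-√p⌉ →
    (⌈2√p-√q⌉ : ℤ) → IsCeiling (ℕ→ℝ 2 *ᴿ √p -ᴿ √q) ⌈2√p-√q⌉ →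
    (⌈√r-√q⌉ : ℤ) → IsCeiling (√r -ᴿ √q) ⌈√r-√q⌉ →
    let N₁ = ℤ→ℝ (⌈2√q-√p⌉ ℤ.⊔ ⌈√r-√p⌉) -ᴿ √p
        N₂ = ℤ→ℝ (⌈2√p-√q⌉ ℤ.⊔ ⌈√r-√q⌉) -ᴿ √q
        bound₁ = ℕ→ℝ m +ᴿ √ (ℕ→ℝ (2 * m) *ᴿ N₁)
        bound₂ = ℕ→ℝ m +ᴿ √ (ℕ→ℝ (2 * m) *ᴿ N₂)
    in
    0ℝ ≤ᴿ N₁ → 0ℝ ≤ᴿ N₂ →
    bound₁ *ᴿ bound₁ ≤ᴿ ℕ→ℝ p →
    bound₂ *ᴿ bound₂ ≤ᴿ ℕ→ℝ q →
    ¬ ((_·𝒪⁺ p q m) ⊆ SumOfSquares p q)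
theorem2 p q r m κ 2≤p 2≤q p-sf q-sf p≡2 q≡3 rgg≡pq p<q q<r 1≤m 1≤κ
  C isCeiling 16mκC<r M₁ _ M₂ _ _ _ _ _ 0≤N₁ _ bound₁²≤p _ = conclude
    (sqrt≤ᴿ⇒square {√ (ℕ→ℝ r)} C (√-isSqrt r) (proj₂ isCeiling))
    (0≤ᴿ-sqrt⇒square {√ (ℕ→ℝ p)} (M₁ ℤ.⊔ M₂) (√-isSqrt p) 0≤N₁)
    (boundᴿ⇒m*M≤p {√ (ℕ→ℝ p)} m p (M₁ ℤ.⊔ M₂) 1≤m (√-isSqrt p) {√ X} (√-nonNeg X) (√-upper X) bound₁²≤p)
  where
  X = ℕ→ℝ (2 * m) *ᴿ (ℤ→ℝ (M₁ ℤ.⊔ M₂) -ᴿ √ (ℕ→ℝ p))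
  conclude : ∃[ c ] (C ≡ + c × r ≤ c * c) → ∃[ k ] (M₁ ℤ.⊔ M₂ ≡ + k × p ≤ k * k) →
             + m ℤ.* (M₁ ℤ.⊔ M₂) ℤ.≤ + p → ¬ ((_·𝒪⁺ p q m) ⊆ SumOfSquares p q)
  conclude (c , C≡c , r≤cc) (k , M≡k , p≤kk) mM≤p =
    minimum-admissible c k (ℕ.<⇒≤ 2≤p) p≡2 q≡3 p-sf q-sf rgg≡pq 1≤m 1≤κ
      (ℕ.≤-trans (ℕ.<⇒≤ (ℕ.<-trans p<q q<r)) r≤cc) p≤kk 16mκc<r mk≤p
    where
    16mκc<r : m * (16 * κ * c) < r
    16mκc<r = ℤ.drop‿+<+ (subst (ℤ._< + r)
      (trans (cong (λ C → + m ℤ.* (+ 16 ℤ.* + κ ℤ.* C)) C≡c)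
        (trans (cong (λ t → + m ℤ.* (t ℤ.* + c)) (sym (ℤ.pos-* 16 κ)))
          (trans (cong (+ m ℤ.*_) (sym (ℤ.pos-* (16 * κ) c))) (sym (ℤ.pos-* m (16 * κ * c))))))
      16mκC<r)
    mk≤p : m * k ≤ p
    mk≤p = ℤ.drop‿+≤+ (subst (ℤ._≤ + p) (trans (cong (+ m ℤ.*_) M≡k) (sym (ℤ.pos-* m k))) mM≤p)
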